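{- Let $G$ be a finite simple graph that is $(P_2\cup P_4,\ \text{diamond})$-free, and let $\chi(G)$ and $\omega(G)$ denote its chromatic number and clique number. Then $\chi(G)\le 4$ if $\omega(G)=2$; $\chi(G)\le 6$ if $\omega(G)=3$; and $\chi(G)=\omega(G)$ if $\omega(G)\ge 4$. Furthermore, each of these bounds is tight: there exists a $(P_2\cup P_4,\ \text{diamond})$-free graph with $\omega=2$ and $\chi=4$, and there exists a $(P_2\cup P_4,\ \text{diamond})$-free graph with $\omega=3$ and $\chi=6$.
   Context: $P_n$ denotes the path on $n$ vertices; $P_2\cup P_4$ is the disjoint union of a $P_2$ and a $P_4$ (no edges between them). The diamond is the graph obtained from $K_4$ by deleting one edge (equivalently, a $P_3$ plus a vertex adjacent to all three vertices of the $P_3$). A graph is $\mathcal{H}$-free if it contains no induced subgraph isomorphic to any member of $\mathcal{H}$. -}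

module Defs where

open import Data.Nat using (ℕ; suc; _≡ᵇ_)
open import Data.Bool using (Bool; true; false; _∧_; _∨_)
open import Data.Fin using (Fin; toℕ)
open import Data.List using (List; []; _∷_)
open import Data.Bool.ListAction using (any)
open import Data.Product using (Σ; _×_; _,_)
open import Relation.Binary.PropositionalEquality using (_≡_; _≢_)
open import Relation.Nullary using (¬_)
open import Function.Definitions using (Injective)

record Graph : Set where
  field
    n     : ℕ
    adj   : Fin n → Fin n → Bool
    sym   : ∀ u v → adj u v ≡ adj v u
    irrefl : ∀ v → adj v v ≡ false
open Graph public

edgesAdj : {k : ℕ} → List (ℕ × ℕ) → Fin k → Fin k → Bool
edgesAdj es u v = any (λ { (a , b) → ((toℕ u ≡ᵇ a) ∧ (toℕ v ≡ᵇ b)) ∨ ((toℕ u ≡ᵇ b) ∧ (toℕ v ≡ᵇ a)) }) es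

InducedSub : (k : ℕ) → (Fin k → Fin k → Bool) → Graph → Set
InducedSub k h G = Σ (Fin k → Fin (n G)) λ f →
  Injective _≡_ _≡_ f × (∀ i j → adj G (f i) (f j) ≡ h i j)

P2∪P4 : Fin 6 → Fin 6 → Bool
P2∪P4 = edgesAdj ((0 , 1) ∷ (2 , 3) ∷ (3 , 4) ∷ (4 , 5) ∷ [])

diamond : Fin 4 → Fin 4 → Bool
diamond = edgesAdj ((0 , 1) ∷ (0 , 2) ∷ (1 , 2) ∷ (1 , 3) ∷ (2 , 3) ∷ [])

P2∪P4-Diamond-Free : Graph → Set
P2∪P4-Diamond-Free G = ¬ InducedSub 6 P2∪P4 G × ¬ InducedSub 4 diamond G

HasClique : Graph → ℕ → Set
HasClique G k = Σ (Fin k → Fin (n G)) λ f →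
  Injective _≡_ _≡_ f × (∀ i j → i ≢ j → adj G (f i) (f j) ≡ true)

IsCliqueNumber : Graph → ℕ → Set
IsCliqueNumber G w = HasClique G w × ¬ HasClique G (suc w)

Colourable : Graph → ℕ → Set
Colourable G c = Σ (Fin (n G) → Fin c) λ col →
  ∀ u v → adj G u v ≡ true → col u ≢ col v

open import Data.Nat using (_≤_)
IsChromaticNumber : Graph → ℕ → Set
IsChromaticNumber G c = Colourable G c × (∀ d → Colourable G d → c ≤ d)

{-# OPTIONS --safe #-}

-- The vertices off an edge uv induce a P₄-free graph.  In a P₄-free, diamond-free graph some two
-- vertices of any triangle are true twins; so, unless it is triangle-free, hence bipartite, it can be
-- coloured by deleting one of them.
-- For ω = 2 the independent sets N(u) and N(v) use two further colours.  For ω = 3, N(u) and N(v) are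
-- matchings, which remain bipartite after adding one vertex each: this suffices when two vertices meet
-- all triangles off uv.  Otherwise there are three pairwise anticomplete triangles, and deleting one of
-- them leaves a P₄-free graph.
-- For ω ≥ 4 let K be a maximum clique; a vertex off K has at most one neighbour in K.  If G − K is
-- P₄-free it reduces to a bipartite graph, of which each side needs two colours of K.  A P₄ in G − K sees
-- all but at most one vertex of K, so ω ≤ 5, and K together with the P₄ is one of finitely many patterns.
-- With at most one vertex more, the pattern makes any two vertices of the same colour nonadjacent when
-- each vertex is coloured, by a table, according to its neighbours in the pattern.
-- The bounds are attained by the Grötzsch graph and by the meeting graph of the 27 lines on a cubic surface.
module Submission where

open import Defs
open import Data.Nat using (ℕ; _≤_)
open import Data.Product using (Σ; _×_)
open import Relation.Binary.PropositionalEquality using (_≡_)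

open import Data.Bool using (Bool; true; false; T; not; if_then_else_; _∧_)
open import Data.Bool.ListAction using (any)
open import Data.Bool.Properties as Bool using (T?; T-∧; ¬-not)
open import Data.Empty using (⊥; ⊥-elim)
open import Data.Fin as Fin using (Fin; zero; suc; toℕ; #_; join; splitAt; inject≤; opposite)
open import Data.Fin.Patterns
open import Data.Fin.Permutation.Components using (transpose; transpose-inverse)
open import Data.Fin.Properties as Fin using (any?; all?; splitAt-join; inject≤-injective; injective⇒≤)
open import Data.List as List using (List; []; _∷_; allFin; concatMap; filter; length)
open import Data.List.Membership.Propositional using (_∈_; find; lose)
open import Data.List.Membership.Propositional.Properties
  using (∈-filter⁺; ∈-filter⁻; ∈-concatMap⁺; ∈-tabulate⁺; ∈-tabulate⁻; ∈-allFin)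
open import Data.List.Properties using (filter-notAll)
open import Data.List.Relation.Unary.All as All using (All; []; _∷_)
open import Data.List.Relation.Unary.All.Properties as All using (all-filter; All¬⇒¬Any)
open import Data.List.Relation.Unary.Any as Any using (Any; here; there)
open import Data.List.Relation.Unary.Any.Properties using (any⁻)
open import Data.Maybe using (Maybe; just; nothing)
import Data.Maybe.Relation.Unary.All as Maybe
open import Data.Nat using (zero; suc; _+_; _*_; _∸_; _<_; _≡ᵇ_; _<ᵇ_; z≤n; s≤s)
open import Data.Nat.Induction using (<-wellFounded)
open import Data.Nat.Properties using (m+[n∸m]≡n; ≤-antisym; ≰⇒>)
open import Data.Product using (∃; _,_; proj₁; proj₂)
open import Data.Sum using (_⊎_; inj₁; inj₂; [_,_]′)
open import Data.Sum.Properties using (inj₁-injective; inj₂-injective)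
open import Data.Vec as Vec using (Vec; []; _∷_; lookup; map; replicate; reverse; tabulate)
open import Data.Vec.Functional using () renaming (_∷_ to _◂_; [] to ε)
open import Data.Vec.Properties
  using (lookup-map; map-∘; map-cong; tabulate-∘; tabulate-cong; tabulate∘lookup; ≡-dec)
open import Data.Vec.Relation.Unary.All as VAll using ([]; _∷_) renaming (All to VAll)
import Data.Vec.Relation.Unary.All.Properties as VAll
open import Data.Vec.Relation.Unary.AllPairs using (AllPairs; []; _∷_; allPairs?)
open import Function using (_∘_; id)
open import Function.Bundles using (Equivalence)
open import Induction.WellFounded using (Acc; acc)
open import Relation.Binary.Definitions using (tri<; tri≈; tri>)
open import Relation.Binary.PropositionalEquality as ≡ using (_≢_; refl; trans; cong; cong₂; subst)
open import Relation.Nullary using (¬_; Dec; yes; no; does; contradiction)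
open import Relation.Nullary.Decidable
  using (True; ¬?; _×-dec_; _⊎-dec_; _→-dec_; toWitness; from-yes; decidable-stable; dec-true; dec-false)

-- Patterns, their copies in a graph, and colour tables indexed by rows

-- Only the Boolean half of the decision is evaluated, so that a large finite check becomes `refl`
-- without normalising its proof half.
holds : ∀ {A : Set} (d : Dec A) → does d ≡ true → A
holds (yes a) _ = a

-- A graph on ordered vertices, newest first: each row relates a vertex to the older ones.
data Pattern : ℕ → Set where
  []  : Pattern 0
  _▸_ : ∀ {m} → Vec Bool m → Pattern m → Pattern (suc m)

infixr 5 _▸_

edge : ∀ {m} → Pattern m → Fin m → Fin m → Bool
edge (r ▸ p) zero    zero    = false
edge (r ▸ p) zero    (suc j) = lookup r j
edge (r ▸ p) (suc i) zero    = lookup r i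
edge (r ▸ p) (suc i) (suc j) = edge p i j

Extends : ∀ {A : Set} (_~_ : A → A → Bool) {m} → A → Vec A m → Vec Bool m → Set
Extends _~_ v vs r = map (v ~_) vs ≡ r × VAll (v ≢_) vs

data Copy {A : Set} (_~_ : A → A → Bool) : ∀ {m} → Vec A m → Pattern m → Set where
  []  : Copy _~_ [] []
  _∷_ : ∀ {m v} {vs : Vec A m} {r p} → Extends _~_ v vs r → Copy _~_ vs p → Copy _~_ (v ∷ vs) (r ▸ p)

extensions : ∀ {k m} → Pattern m → Vec Bool k → Vec (Fin m) k → List (Vec (Fin m) (suc k))
extensions p r xs = List.map (_∷ xs) (filter extends? (allFin _))
  where
  extends? : ∀ x → Dec (Extends (edge p) x xs r)
  extends? x = ≡-dec Bool._≟_ (map (edge p x) xs) r ×-dec VAll.all? (λ y → ¬? (x Fin.≟ y)) xs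

copies : ∀ {k m} → Pattern k → Pattern m → List (Vec (Fin m) k)
copies []      p = [] ∷ []
copies (r ▸ F) p = concatMap (extensions p r) (copies F p)

-- Soundness suffices: an overlooked copy would only weaken the pruning of rows.
copies-sound : ∀ {k m} (F : Pattern k) (p : Pattern m) → All (λ xs → Copy (edge p) xs F) (copies F p)
copies-sound []      p = [] ∷ []
copies-sound (r ▸ F) p = All.concat⁺ (All.map⁺ (All.map extend (copies-sound F p)))
  where
  extend : ∀ {xs} → Copy (edge p) xs F → All (λ ys → Copy (edge p) ys (r ▸ F)) (extensions p r xs)
  extend c = All.map⁺ (All.map (_∷ c) (all-filter _ (allFin _)))

-- Nested conditionals make evaluation stop at the first mismatch; the search compares a great many
-- rows.
agrees : ∀ {A : Set} {k} → (A → Bool) → Vec A k → Vec Bool k → Bool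
agrees f []       []          = true
agrees f (x ∷ xs) (true ∷ r)  = if f x then agrees f xs r else false
agrees f (x ∷ xs) (false ∷ r) = if f x then false else agrees f xs r

agrees-sound : ∀ {A : Set} {k} (f : A → Bool) (xs : Vec A k) r → T (agrees f xs r) → map f xs ≡ r
agrees-sound f []       []          _ = refl
agrees-sound f (x ∷ xs) (true ∷ r)  t with f x
... | true = cong (true ∷_) (agrees-sound f xs r t)
agrees-sound f (x ∷ xs) (false ∷ r) t with f x
... | false = cong (false ∷_) (agrees-sound f xs r t)

-- The newest vertex is the least significant bit.
code : ∀ {m} → Vec Bool m → ℕ
code []      = 0
code (b ∷ r) = (if b then 1 else 0) + 2 * code r

colourOf : ∀ {c} → Vec (List ℕ) c → ℕ → Fin (suc c)
colourOf []         x = zero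
colourOf (cl ∷ cls) x = if any (x ≡ᵇ_) cl then zero else suc (colourOf cls x)

assoc : ∀ {A : Set} → ℕ → List (ℕ × A) → Maybe A
assoc x []             = nothing
assoc x ((y , a) ∷ as) = if x ≡ᵇ y then just a else assoc x as

nothing? : ∀ {A : Set} (x : Maybe A) → Dec (x ≡ nothing)
nothing? nothing  = yes refl
nothing? (just _) = no λ ()

prolongations : ∀ {m} → Vec Bool m → List (Vec Bool (suc m))
prolongations t = (false ∷ t) ∷ (true ∷ t) ∷ []

Table : ℕ → Set
Table c = Vec (List ℕ) c

-- A vertex off the pattern gets as its colour the position of the list in `main` that contains
-- the code of its row, or c when there is none.  If a row with an exceptional code occurs, such
-- a vertex joins the pattern instead and the table of that exception is used.
record Plan (c : ℕ) : Set where
  constructor plan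
  field
    main       : Table c
    exceptions : List (ℕ × Table c)

-- A graph with a distinguished edge: the rows of its two ends over the other vertices.
record Rooted : Set where
  constructor rooted
  field
    {size} : ℕ
    rowˡ rowʳ : Vec Bool size
    rest : Pattern size

open Rooted

whole : (F : Rooted) → Pattern (2 + size F)
whole F = (true ∷ rowˡ F) ▸ rowʳ F ▸ rest F

-- The finite check of a colour table against a list of forbidden graphs

module Search (forbidden : List Rooted) where

  -- Partial copies of a forbidden graph, lacking one vertex or the ends of the distinguished edge,
  -- with the rows the missing vertices would need.
  Obstruction₁ Obstruction₂ : ℕ → Set
  Obstruction₁ m = ∃ λ k → Vec Bool k × Vec (Fin m) k
  Obstruction₂ m = ∃ λ k → Vec Bool k × Vec Bool k × Vec (Fin m) k

  obstructions₁ : ∀ {m} → Pattern m → List (Obstruction₁ m)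
  obstructions₁ p = concatMap (λ F → List.map (λ xs → _ , true ∷ rowˡ F , xs) (copies (rowʳ F ▸ rest F) p))
    forbidden

  obstructions₂ : ∀ {m} → Pattern m → List (Obstruction₂ m)
  obstructions₂ p = concatMap (λ F → List.map (λ xs → _ , rowˡ F , rowʳ F , xs) (copies (rest F) p)) forbidden

  blocked₁ : ∀ {m} → List (Obstruction₁ m) → Vec Bool m → Bool
  blocked₁ os t = any (λ { (_ , r , xs) → agrees (lookup t) xs r }) os

  blocked₂ : ∀ {m} → List (Obstruction₂ m) → Vec Bool m → Vec Bool m → Bool
  blocked₂ os t s = any (λ { (_ , r , q , xs) → agrees (lookup t) xs r ∧ agrees (lookup s) xs q }) os

  unblocked : ∀ {m} → List (Obstruction₁ m) → List (Vec Bool m) → List (Vec Bool m)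
  unblocked os = filter (λ t → T? (not (blocked₁ os t)))

  -- The candidate rows of a vertex off the pattern, pruned after every vertex so that the lists
  -- stay short. A row that never occurs does no harm beyond an additional check.
  types : ∀ {m} → Pattern m → List (Vec Bool m)
  types []      = [] ∷ []
  types (r ▸ p) = unblocked (obstructions₁ (r ▸ p)) (concatMap prolongations (types p))

  row : ∀ {m} → Pattern m → Fin m → Vec Bool m
  row p i = tabulate (edge p i)

  -- Vertices of the pattern are coloured through their own rows too, so one function of rows
  -- colours the whole graph. In the last clause `t` and `s` may coincide, since different vertices
  -- can share a row.
  Proper : ∀ {m c} → Pattern m → List (Obstruction₂ m) → List (Vec Bool m) → (Vec Bool m → Fin c) → Set
  Proper p os ts φ =
      (∀ i j → edge p i j ≡ true → φ (row p i) ≢ φ (row p j))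
    × All (λ t → ∀ j → lookup t j ≡ true → φ t ≢ φ (row p j)) ts
    × All (λ t → All (λ s → φ t ≡ φ s → T (blocked₂ os t s)) ts) ts

  proper? : ∀ {m c} (p : Pattern m) os ts (φ : Vec Bool m → Fin c) → Dec (Proper p os ts φ)
  proper? p os ts φ =
    all? (λ i → all? λ j → (edge p i j Bool.≟ true) →-dec ¬? (φ (row p i) Fin.≟ φ (row p j)))
    ×-dec All.all? (λ t → all? λ j → (lookup t j Bool.≟ true) →-dec ¬? (φ t Fin.≟ φ (row p j))) ts
    ×-dec All.all? (λ t → All.all? (λ s → (φ t Fin.≟ φ s) →-dec T? _) ts) ts

  open Plan

  kept : ∀ {m c} → Pattern m → Plan c → List (Vec Bool m)
  kept p π = filter (λ t → nothing? (assoc (code t) (exceptions π))) (types p)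

  Good : ∀ {m c} → Pattern m → Plan c → Set
  Good p π = Proper p (obstructions₂ p) (kept p π) (colourOf (main π) ∘ code)
    × All (λ t → Maybe.All (λ table → Proper (t ▸ p) (obstructions₂ (t ▸ p)) (types (t ▸ p)) (colourOf table ∘ code))
                     (assoc (code t) (exceptions π))) (types p)

  good? : ∀ {m c} (p : Pattern m) (π : Plan c) → Dec (Good p π)
  good? p π = proper? p (obstructions₂ p) (kept p π) _
    ×-dec All.all? (λ t → Maybe.dec (λ table → proper? (t ▸ p) (obstructions₂ (t ▸ p)) (types (t ▸ p)) _) _) (types p)

  -- A record, so that comparing two such types compares `p` and `π` instead of running the search
  -- again.
  record Verified {m c} (p : Pattern m) (π : Plan c) : Set where
    constructor evaluated
    field
      evaluation : does (good? p π) ≡ true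

-- Copies of a pattern, and copies inside copies

module _ {A : Set} {_~_ : A → A → Bool}
         (~-sym : ∀ u v → u ~ v ≡ v ~ u) (~-irrefl : ∀ v → v ~ v ≡ false) where

  copy-edge : ∀ {m} {vs : Vec A m} {p} → Copy _~_ vs p → ∀ i j → lookup vs i ~ lookup vs j ≡ edge p i j
  copy-edge ((eq , _) ∷ c) zero    zero    = ~-irrefl _
  copy-edge {vs = v ∷ vs} ((refl , _) ∷ c) zero    (suc j) = ≡.sym (lookup-map j (v ~_) vs)
  copy-edge {vs = v ∷ vs} ((refl , _) ∷ c) (suc i) zero    =
    trans (~-sym _ v) (≡.sym (lookup-map i (v ~_) vs))
  copy-edge (_ ∷ c) (suc i) (suc j) = copy-edge c i j

  copy-distinct : ∀ {m} {vs : Vec A m} {p} → Copy _~_ vs p → ∀ i j → i ≢ j → lookup vs i ≢ lookup vs j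
  copy-distinct c             zero    zero    i≢j = contradiction refl i≢j
  copy-distinct ((_ , f) ∷ c) zero    (suc j) i≢j = VAll.lookup⁺ f j
  copy-distinct ((_ , f) ∷ c) (suc i) zero    i≢j = VAll.lookup⁺ f i ∘ ≡.sym
  copy-distinct (_ ∷ c)       (suc i) (suc j) i≢j = copy-distinct c i j (i≢j ∘ cong suc)

  copy-trans : ∀ {k m} {vs : Vec A m} {p} {xs : Vec (Fin m) k} {F} →
    Copy _~_ vs p → Copy (edge p) xs F → Copy _~_ (map (lookup vs) xs) F
  copy-trans c [] = []
  copy-trans {vs = vs} {xs = x ∷ xs} c ((eq , f) ∷ d) =
    (trans (trans (≡.sym (map-∘ _ (lookup vs) xs)) (map-cong (copy-edge c x) xs)) eq
    , VAll.map⁺ (VAll.map (λ {y} → copy-distinct c x y) f)) ∷ copy-trans c d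

  copy-row : ∀ {m} {vs : Vec A m} {p} → Copy _~_ vs p → ∀ i → map (lookup vs i ~_) vs ≡ tabulate (edge p i)
  copy-row {vs = vs} c i = trans (cong (map _) (≡.sym (tabulate∘lookup vs)))
    (trans (≡.sym (tabulate-∘ (lookup vs i ~_) (lookup vs))) (tabulate-cong (copy-edge c i)))

-- Soundness of the finite check

module Sound (G : Graph) (forbidden : List Rooted)
             (absent : All (λ F → ∀ vs → ¬ Copy (adj G) vs (whole F)) forbidden) where
  open Search forbidden
  open Plan

  Fresh : ∀ {m} → Fin (n G) → Vec (Fin (n G)) m → Set
  Fresh v = VAll (v ≢_)

  locate : ∀ {m} v (vs : Vec (Fin (n G)) m) → (∃ λ i → v ≡ lookup vs i) ⊎ Fresh v vs
  locate v []       = inj₂ []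
  locate v (u ∷ us) with v Fin.≟ u | locate v us
  ... | yes v≡u | _               = inj₁ (zero , v≡u)
  ... | no _    | inj₁ (i , v≡uᵢ) = inj₁ (suc i , v≡uᵢ)
  ... | no v≢u  | inj₂ fresh      = inj₂ (v≢u ∷ fresh)

  ~-sym = Graph.sym G
  ~-irrefl = irrefl G

  extend : ∀ {k m} {vs : Vec _ m} {p} {xs : Vec (Fin m) k} {F r v} → Copy (adj G) vs p →
    Copy (edge p) xs F → Fresh v vs → T (agrees (lookup (map (adj G v) vs)) xs r) →
    Extends (adj G) v (map (lookup vs) xs) r
  extend {vs = vs} {xs = xs} {v = v} c d fresh t =
    trans (≡.sym (map-∘ (adj G v) (lookup vs) xs))
      (trans (map-cong (λ i → ≡.sym (lookup-map i (adj G v) vs)) xs) (agrees-sound _ xs _ t))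
    , VAll.map⁺ (VAll.universal (VAll.lookup⁺ fresh) xs)

  -- A vertex with a blocked row would complete a partial copy inside the pattern to a whole
  -- forbidden graph.
  blocked₁-sound : ∀ {m} {vs : Vec _ m} {p} → Copy (adj G) vs p →
    ∀ {v} → Fresh v vs → ¬ T (blocked₁ (obstructions₁ p) (map (adj G v) vs))
  blocked₁-sound {p = p} c fresh b =
    All¬⇒¬Any (All.concat⁺ (All.map⁺ (All.map (λ {F} → refuted {F}) absent))) (any⁻ _ (obstructions₁ p) b)
    where
    refuted : ∀ {F} → (∀ us → ¬ Copy (adj G) us (whole F)) → All _ _
    refuted {F} none = All.map⁺ (All.map
      (λ d t → none _ (extend c d fresh t ∷ copy-trans ~-sym ~-irrefl c d))
      (copies-sound (rowʳ F ▸ rest F) p))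

  -- The edge `uv` would play the distinguished edge of a forbidden graph whose other vertices lie
  -- in the pattern. Hence vertices whose rows block each other are nonadjacent.
  blocked₂-sound : ∀ {m} {vs : Vec _ m} {p} → Copy (adj G) vs p → ∀ {u v} → Fresh u vs → Fresh v vs →
    adj G u v ≡ true → ¬ T (blocked₂ (obstructions₂ p) (map (adj G u) vs) (map (adj G v) vs))
  blocked₂-sound {p = p} c {u} {v} fu fv uv b =
    All¬⇒¬Any (All.concat⁺ (All.map⁺ (All.map (λ {F} → refuted {F}) absent))) (any⁻ _ (obstructions₂ p) b)
    where
    u≢v : u ≢ v
    u≢v refl with () ← trans (≡.sym uv) (~-irrefl u)
    refuted : ∀ {F} → (∀ us → ¬ Copy (adj G) us (whole F)) → All _ _
    refuted {F} none = All.map⁺ (All.map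
      (λ d t → let tᵘ , tᵛ = Equivalence.to T-∧ t ; eᵘ , fᵘ = extend c d fu tᵘ in
        none _ ((cong₂ _∷_ uv eᵘ , u≢v ∷ fᵘ) ∷ extend c d fv tᵛ ∷ copy-trans ~-sym ~-irrefl c d))
      (copies-sound (rest F) p))

  -- Each stage of `types` discards only rows that `blocked₁-sound` excludes for the part of the
  -- pattern built so far.
  types-complete : ∀ {m} {vs : Vec _ m} {p} → Copy (adj G) vs p →
    ∀ {v} → Fresh v vs → map (adj G v) vs ∈ types p
  types-complete [] _ = here refl
  types-complete {vs = u ∷ us} c₀@((refl , _) ∷ c) {v} fresh@(_ ∷ fresh′) =
    ∈-filter⁺ _ (∈-concatMap⁺ _ (lose (types-complete c fresh′) (split (adj G v u))))
      (¬T⇒T-not (blocked₁-sound c₀ fresh))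
    where
    split : ∀ b {m} {t : Vec Bool m} → (b ∷ t) ∈ prolongations t
    split false = here refl
    split true  = there (here refl)
    ¬T⇒T-not : ∀ {b} → ¬ T b → T (not b)
    ¬T⇒T-not {false} _ = _
    ¬T⇒T-not {true}  f = ⊥-elim (f _)

  -- The three clauses of `Proper` treat the edges with two, one and no ends in the pattern; in the
  -- last case equal colours block the edge.
  proper-sound : ∀ {m c} {vs : Vec _ m} {p ts} {φ : Vec Bool m → Fin c} → Copy (adj G) vs p →
    Proper p (obstructions₂ p) ts φ → (∀ v → Fresh v vs → map (adj G v) vs ∈ ts) → Colourable G c
  proper-sound {vs = vs} {p} {ts} {φ} c (base , mixed , new) complete = col , proper
    where
    col : Fin (n G) → Fin _
    col v = φ (map (adj G v) vs)
    old : ∀ i {v} → v ≡ lookup vs i → col v ≡ φ (row p i)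
    old i refl = cong φ (copy-row ~-sym ~-irrefl c i)
    one-old : ∀ {u v} → adj G u v ≡ true → Fresh u vs → (∃ λ i → v ≡ lookup vs i) → col u ≢ col v
    one-old {u} uv fu (i , v≡) eq = All.lookup mixed (complete u fu) i
      (trans (lookup-map i (adj G u) vs) (trans (cong (adj G u) (≡.sym v≡)) uv)) (trans eq (old i v≡))
    proper : ∀ u v → adj G u v ≡ true → col u ≢ col v
    proper u v uv eq with locate u vs | locate v vs
    ... | inj₁ (i , refl) | inj₁ (j , refl) =
      base i j (trans (≡.sym (copy-edge ~-sym ~-irrefl c i j)) uv)
        (trans (≡.sym (old i refl)) (trans eq (old j refl)))
    ... | inj₂ fu | inj₁ v∈ = one-old uv fu v∈ eq
    ... | inj₁ u∈ | inj₂ fv = one-old (trans (Graph.sym G v u) uv) fv u∈ (≡.sym eq)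
    ... | inj₂ fu | inj₂ fv =
      blocked₂-sound c fu fv uv
        (All.lookup (All.lookup new (complete u fu)) (complete v fv) eq)

  good-sound : ∀ {m c} {vs : Vec _ m} {p} (π : Plan c) → Verified p π → Copy (adj G) vs p → Colourable G (suc c)
  good-sound {vs = vs} {p} π v c with (main-ok , exc-ok) ← holds (good? p π) (Verified.evaluation v)
    with any? (λ v → VAll.all? (λ u → ¬? (v Fin.≟ u)) vs ×-dec
                     ¬? (nothing? (assoc (code (map (adj G v) vs)) (exceptions π))))
  ... | no none = proper-sound c main-ok λ v fresh → ∈-filter⁺ _ (types-complete c fresh)
          (decidable-stable (nothing? _) λ some → none (v , fresh , some))
  ... | yes (v , fresh , some) with assoc (code (map (adj G v) vs)) (exceptions π)
                                    | All.lookup exc-ok (types-complete c fresh)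
  ... | nothing | _              = contradiction refl some
  ... | just _  | Maybe.just ok = proper-sound c′ ok λ _ → types-complete c′
    where
    c′ : Copy (adj G) (v ∷ vs) (map (adj G v) vs ▸ p)
    c′ = (refl , fresh) ∷ c

-- Colouring sets of vertices; triangle-free P₄-free sets are bipartite

module Adjacency (G : Graph) where

  V : Set
  V = Fin (n G)

  infix 4 _~_ _≁_ _~?_

  _~_ _≁_ : V → V → Set
  u ~ v = adj G u v ≡ true
  u ≁ v = ¬ u ~ v

  _~?_ : ∀ u v → Dec (u ~ v)
  u ~? v = adj G u v Bool.≟ true

  ~-stable : ∀ {u v} → ¬ u ≁ v → u ~ v
  ~-stable = decidable-stable (_ ~? _)

  ~-sym : ∀ {u v} → u ~ v → v ~ u
  ~-sym = trans (Graph.sym G _ _)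

  ≁-sym : ∀ {u v} → u ≁ v → v ≁ u
  ≁-sym u≁v = u≁v ∘ ~-sym

  ~⇒≢ : ∀ {u v} → u ~ v → u ≢ v
  ~⇒≢ {u} uv refl with () ← trans (≡.sym uv) (irrefl G u)

  -- Distinctness of the vertices follows from the prescribed adjacencies and nonadjacencies.
  P4Free TriangleFree : (V → Set) → Set
  P4Free P = ∀ {a b c d} → P a → P b → P c → P d → a ~ b → b ~ c → c ~ d → a ≁ c → a ≁ d → b ≁ d → ⊥
  TriangleFree P = ∀ {a b c} → P a → P b → P c → a ~ b → b ~ c → a ~ c → ⊥

  -- What excluding the diamond, respectively P₂ ∪ P₄, says about a single edge.
  DiamondFree P4FreeOffEdges : Set
  DiamondFree = ∀ {p q x y} → p ~ q → x ~ p → x ~ q → y ~ p → y ~ q → x ≢ y → x ~ y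
  P4FreeOffEdges = ∀ {u v} → u ~ v → P4Free (λ x → x ≁ u × x ≁ v)

  P4Free-⊆ : ∀ {P Q : V → Set} → (∀ {v} → P v → Q v) → P4Free Q → P4Free P
  P4Free-⊆ f free a b c d = free (f a) (f b) (f c) (f d)

  Proper : ∀ {c} → (V → Set) → (V → Fin c) → Set
  Proper P col = ∀ {u v} → P u → P v → u ~ v → col u ≢ col v

  ColourableOn : (V → Set) → ℕ → Set
  ColourableOn P c = Σ (V → Fin c) (Proper P)

  colourable : ∀ {P c} → (∀ v → P v) → ColourableOn P c → Colourable G c
  colourable all (col , proper) = col , λ u v → proper (all u) (all v)

  colour-inject : ∀ {P c d} → c ≤ d → ColourableOn P c → ColourableOn P d
  colour-inject c≤d (col , proper) =
    (λ v → inject≤ (col v) c≤d) , λ Pu Pv uv eq → proper Pu Pv uv (inject≤-injective c≤d c≤d _ _ eq)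

  colour-∪ : ∀ {P Q : V → Set} {c d} → (∀ v → Dec (P v)) →
    ColourableOn P c → ColourableOn Q d → ColourableOn (λ v → P v ⊎ Q v) (c + d)
  colour-∪ {P} {Q} {c} {d} P? (f , f-proper) (g , g-proper) = col , proper
    where
    side : ∀ {v} → Dec (P v) → Fin c ⊎ Fin d
    side {v} (yes _) = inj₁ (f v)
    side {v} (no _)  = inj₂ (g v)
    col : V → Fin (c + d)
    col v = join c d (side (P? v))
    remaining : ∀ {v} → ¬ P v → P v ⊎ Q v → Q v
    remaining ¬Pv = [ (λ Pv → contradiction Pv ¬Pv) , id ]′
    join-injective : ∀ {x y} → join c d x ≡ join c d y → x ≡ y
    join-injective {x} {y} eq = trans (≡.sym (splitAt-join c d x)) (trans (cong (splitAt c) eq) (splitAt-join c d y))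
    proper : Proper (λ v → P v ⊎ Q v) col
    proper {u} {v} hu hv uv eq with P? u | P? v | join-injective {side (P? u)} {side (P? v)} eq
    ... | yes Pu | yes Pv | e  = f-proper Pu Pv uv (inj₁-injective e)
    ... | no ¬Pu | no ¬Pv | e  = g-proper (remaining ¬Pu hu) (remaining ¬Pv hv) uv (inj₂-injective e)
    ... | yes _  | no _   | ()
    ... | no _   | yes _  | ()

  colour-independent : ∀ {P} → (∀ {u v} → P u → P v → u ≁ v) → ColourableOn P 1
  colour-independent indep = (λ _ → zero) , λ Pu Pv uv _ → indep Pu Pv uv

  _[_↦_] : ∀ {c} → (V → Fin c) → V → Fin c → V → Fin c
  (col [ x ↦ c ]) y with y Fin.≟ x
  ... | yes _ = c
  ... | no _  = col y

  recolour : ∀ {c} {P : V → Set} {col : V → Fin c} {x m} → Proper (λ v → P v × v ≢ x) col →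
    (∀ {y} → P y → y ≢ x → y ~ x → col y ≢ m) → Proper P (col [ x ↦ m ])
  recolour {x = x} proper avoid {u} {v} Pu Pv uv with u Fin.≟ x | v Fin.≟ x
  ... | yes refl | yes refl = λ _ → ~⇒≢ uv refl
  ... | yes refl | no v≢x   = avoid Pv v≢x (~-sym uv) ∘ ≡.sym
  ... | no u≢x   | yes refl = avoid Pu u≢x uv
  ... | no u≢x   | no v≢x   = proper (Pu , u≢x) (Pv , v≢x) uv

  infixl 6 _∖_

  _∖_ : List V → V → List V
  S ∖ x = filter (λ y → ¬? (y Fin.≟ x)) S

  ∈-∖⁺ : ∀ {S x y} → y ∈ S → y ≢ x → y ∈ S ∖ x
  ∈-∖⁺ = ∈-filter⁺ _

  ∈-∖⁻ : ∀ {S x y} → y ∈ S ∖ x → y ∈ S × y ≢ x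
  ∈-∖⁻ {S} = ∈-filter⁻ _ {xs = S}

  ∖-induction : (P : List V → Set) → (∀ S → (∀ {x} → x ∈ S → P (S ∖ x)) → P S) → ∀ S → P S
  ∖-induction P step S = go S (<-wellFounded (length S))
    where
    go : ∀ S → Acc _<_ (length S) → P S
    go S (acc rs) = step S λ x∈S → go _ (rs (filter-notAll _ S (Any.map (λ { refl ≢x → ≢x refl }) x∈S)))

  triangle? : ∀ S → (∃ λ x → ∃ λ y → ∃ λ z → (x ∈ S × y ∈ S × z ∈ S) × (x ~ y × y ~ z × x ~ z)) ⊎ TriangleFree (_∈ S)
  triangle? S with Any.any? (λ x → Any.any? (λ y → Any.any? (λ z → (x ~? y) ×-dec (y ~? z) ×-dec (x ~? z)) S) S) S
  ... | no none = inj₂ λ a b c ab bc ac → none (lose a (lose b (lose c (ab , bc , ac))))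
  ... | yes found with x , x∈ , found′ ← find found with y , y∈ , found″ ← find found′ with z , z∈ , t ← find found″ =
    inj₁ (x , y , z , (x∈ , y∈ , z∈) , t)

  -- Induction removes one vertex: an isolated `x`; or `x` with a vertex `u` at distance two, whose
  -- colour it takes; or a neighbour `v` of `x` without further neighbours, which is coloured
  -- opposite to `x`.
  colour-bipartite : ∀ S → P4Free (_∈ S) → TriangleFree (_∈ S) → ColourableOn (_∈ S) 2
  colour-bipartite = ∖-induction _ step
    where
    step : ∀ S → (∀ {x} → x ∈ S → P4Free (_∈ S ∖ x) → TriangleFree (_∈ S ∖ x) → ColourableOn (_∈ S ∖ x) 2) →
      P4Free (_∈ S) → TriangleFree (_∈ S) → ColourableOn (_∈ S) 2
    step [] _ _ _ = (λ _ → zero) , λ ()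
    step S@(x ∷ _) ih p4 tri = result
      where
      x∈S : x ∈ S
      x∈S = here refl
      without : ∀ {v} → v ∈ S → Σ (V → Fin 2) λ col → Proper (λ u → u ∈ S × u ≢ v) col
      without {v} v∈S with col , proper ← ih v∈S (P4Free-⊆ (proj₁ ∘ ∈-∖⁻) p4)
          (λ a b c → tri (proj₁ (∈-∖⁻ a)) (proj₁ (∈-∖⁻ b)) (proj₁ (∈-∖⁻ c))) =
        col , λ (Pu , u≢) (Pv , v≢) → proper (∈-∖⁺ Pu u≢) (∈-∖⁺ Pv v≢)
      opposite-≢ : ∀ (i : Fin 2) → i ≢ opposite i
      opposite-≢ zero ()
      opposite-≢ (suc zero) ()
      result : ColourableOn (_∈ S) 2
      result with Any.any? (x ~?_) S
      ... | no isolated with col , proper ← without x∈S =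
        col [ x ↦ zero ] , recolour proper λ y∈S _ yx _ → isolated (lose y∈S (~-sym yx))
      ... | yes has-neighbour with v , v∈S , xv ← find has-neighbour
          with Any.any? (λ u → (u ~? v) ×-dec ¬? (u Fin.≟ x)) S
      ...   | yes second with u , u∈S , uv , u≢x ← find second with col , proper ← without x∈S =
        -- Here u and x have the same neighbours.
        col [ x ↦ col u ] , recolour proper λ y∈S y≢x yx → proper (y∈S , y≢x) (u∈S , u≢x) (~-stable λ y≁u →
          p4 y∈S x∈S v∈S u∈S yx xv (~-sym uv)
            (λ yv → tri y∈S x∈S v∈S yx xv yv) y≁u (λ xu → tri x∈S u∈S v∈S xu uv xv))
      ...   | no leaf with col , proper ← without v∈S =
        col [ v ↦ opposite (col x) ] , recolour proper avoid
        where
        avoid : ∀ {y} → y ∈ S → y ≢ v → y ~ v → col y ≢ opposite (col x)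
        avoid {y} y∈S _ yv with y Fin.≟ x
        ... | yes refl = opposite-≢ (col x)
        ... | no y≢x   = λ _ → leaf (lose y∈S (yv , y≢x))

  Clique : ∀ {k} → (Fin k → V) → Set
  Clique f = ∀ i j → i ≢ j → f i ~ f j

  clique-[] : ∀ {f : Fin 0 → V} → Clique f
  clique-[] ()

  clique-◂ : ∀ {k x} {f : Fin k → V} → (∀ i → x ~ f i) → Clique f → Clique (x ◂ f)
  clique-◂ xf c zero    zero    i≢j = contradiction refl i≢j
  clique-◂ xf c zero    (suc j) _   = xf j
  clique-◂ xf c (suc i) zero    _   = ~-sym (xf i)
  clique-◂ xf c (suc i) (suc j) i≢j = c i j (i≢j ∘ cong suc)

  hasClique : ∀ {k} {f : Fin k → V} → Clique f → HasClique G k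
  hasClique {f = f} c = f , (λ {i} {j} → injective i j) , c
    where
    injective : ∀ i j → f i ≡ f j → i ≡ j
    injective i j eq with i Fin.≟ j
    ... | yes i≡j = i≡j
    ... | no i≢j  = contradiction eq (~⇒≢ (c i j i≢j))

  triangle-clique : ∀ {x y z} → x ~ y → y ~ z → x ~ z → HasClique G 3
  triangle-clique {x} {y} {z} xy yz xz = hasClique {f = x ◂ y ◂ z ◂ ε}
    (clique-◂ (λ { zero → xy ; (suc zero) → xz }) (clique-◂ (λ { zero → yz }) (clique-◂ (λ ()) (clique-[] {ε}))))

  K4-clique : ∀ {x y z t} → x ~ y → y ~ z → x ~ z → x ~ t → y ~ t → z ~ t → HasClique G 4
  K4-clique {x} {y} {z} {t} xy yz xz xt yt zt = hasClique {f = x ◂ y ◂ z ◂ t ◂ ε}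
    (clique-◂ (λ { zero → xy ; (suc zero) → xz ; (suc (suc zero)) → xt })
      (clique-◂ (λ { zero → yz ; (suc zero) → yt })
        (clique-◂ (λ { zero → zt }) (clique-◂ (λ ()) (clique-[] {ε})))))

-- Twins in triangles of P₄-free sets, and the reduction to triangle-free sets

module Diamond-free (G : Graph) (diamond-free : Adjacency.DiamondFree G) where

  open Adjacency G

  -- A contact is a witness against `Twins`, which is one of the two inclusions that make true
  -- twins.
  Contact : (V → Set) → V → V → V → Set
  Contact P p q s = P s × s ~ p × s ≢ q × s ≁ q

  Twins : (V → Set) → V → V → Set
  Twins P x y = ∀ {s} → P s → s ~ x → s ≢ y → s ~ y

  module _ {P : V → Set} where

    -- Were `s` adjacent to `r`, then `s` and `q` would be common neighbours of the edge `pr`, hence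
    -- adjacent.
    contact-swap : ∀ {p q r s} → p ~ q → q ~ r → p ~ r → Contact P p q s → Contact P p r s
    contact-swap pq qr pr (Ps , sp , s≢q , s≁q) =
      Ps , sp , (λ { refl → s≁q (~-sym qr) }) , λ sr → s≁q (diamond-free pr sp sr (~-sym pq) qr s≢q)

    -- If `s` and `t` are adjacent, then s, t, q, r is an induced P₄; otherwise s, p, q, t is one.
    no-two-contacts : ∀ {p q r s t} → P4Free P → P p → P q → P r → p ~ q → q ~ r → p ~ r →
      Contact P p q s → Contact P q p t → ⊥
    no-two-contacts {s = s} {t} p4 Pp Pq Pr pq qr pr cs@(Ps , sp , s≢q , s≁q) ct@(Pt , tq , t≢p , t≁p)
      with s≁r ← proj₂ (proj₂ (proj₂ (contact-swap pq qr pr cs)))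
         | t≁r ← proj₂ (proj₂ (proj₂ (contact-swap (~-sym pq) pr qr ct)))
         | s ~? t
    ... | yes st = p4 Ps Pt Pq Pr st tq qr s≁q s≁r t≁r
    ... | no s≁t = p4 Ps Pp Pq Pt sp pq (~-sym tq) s≁q s≁t (≁-sym t≁p)

  contact? : ∀ S p q → Dec (∃ (Contact (_∈ S) p q))
  contact? S p q with Any.any? (λ s → (s ~? p) ×-dec ¬? (s Fin.≟ q) ×-dec ¬? (s ~? q)) S
  ... | yes found = yes (let s , s∈ , c = find found in s , s∈ , c)
  ... | no none   = no λ (s , s∈ , c) → none (lose s∈ c)

  no-contact⇒twins : ∀ {P p q} → ¬ ∃ (Contact P p q) → Twins P p q
  no-contact⇒twins none Ps sp s≢q = ~-stable λ s≁q → none (_ , Ps , sp , s≢q , s≁q)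

  -- The twins are `x` and `y`. The parameter `R` lets a further property of the vertices survive
  -- their renaming.
  record TwinTriangle (S : List V) (R : V → Set) : Set where
    field
      {x y z} : V
      x∈ : x ∈ S
      y∈ : y ∈ S
      z∈ : z ∈ S
      Rx : R x
      Ry : R y
      Rz : R z
      xy : x ~ y
      yz : y ~ z
      xz : x ~ z
      x-twin : Twins (_∈ S) x y
      y-twin : Twins (_∈ S) y x

  -- By `no-two-contacts` at most one vertex of the triangle has a contact; the other two are the
  -- twins.
  twin-triangle : ∀ {S p q r} {R : V → Set} → P4Free (_∈ S) → p ∈ S → q ∈ S → r ∈ S → R p → R q → R r →
    p ~ q → q ~ r → p ~ r → TwinTriangle S R
  twin-triangle {S} {p} {q} {r} p4 p∈ q∈ r∈ Rp Rq Rr pq qr pr with contact? S p q | contact? S q p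
  ... | no ¬pq | no ¬qp = record
      { x∈ = p∈ ; y∈ = q∈ ; z∈ = r∈ ; Rx = Rp ; Ry = Rq ; Rz = Rr ; xy = pq ; yz = qr ; xz = pr
      ; x-twin = no-contact⇒twins {P = _∈ S} ¬pq ; y-twin = no-contact⇒twins {P = _∈ S} ¬qp }
  ... | yes (s , cs) | _ = record
      { x∈ = q∈ ; y∈ = r∈ ; z∈ = p∈ ; Rx = Rq ; Ry = Rr ; Rz = Rp ; xy = qr ; yz = ~-sym pr ; xz = ~-sym pq
      ; x-twin = no-contact⇒twins {P = _∈ S} λ (t , ct) → no-two-contacts {P = _∈ S} p4 p∈ q∈ r∈ pq qr pr cs
          (contact-swap {P = _∈ S} qr (~-sym pr) (~-sym pq) ct)
      ; y-twin = no-contact⇒twins {P = _∈ S} λ (t , ct) → no-two-contacts {P = _∈ S} p4 p∈ r∈ q∈ pr (~-sym qr) pq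
          (contact-swap {P = _∈ S} pq qr pr cs) (contact-swap {P = _∈ S} (~-sym qr) (~-sym pq) (~-sym pr) ct) }
  ... | no ¬pq | yes (s , cs) = record
      { x∈ = p∈ ; y∈ = r∈ ; z∈ = q∈ ; Rx = Rp ; Ry = Rr ; Rz = Rq ; xy = pr ; yz = ~-sym qr ; xz = pq
      ; x-twin = no-contact⇒twins {P = _∈ S} λ (t , ct) → ¬pq (t , contact-swap {P = _∈ S} pr (~-sym qr) pq ct)
      ; y-twin = no-contact⇒twins {P = _∈ S} λ (t , ct) → no-two-contacts {P = _∈ S} p4 q∈ r∈ p∈ qr (~-sym pr) (~-sym pq)
          (contact-swap {P = _∈ S} (~-sym pq) pr qr cs) (contact-swap {P = _∈ S} (~-sym pr) pq (~-sym qr) ct) }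

  -- S is reduced to a triangle-free set by deleting ends x of twin pairs x, y.  When every
  -- colour already occurs next to x, one of them, m, occurs there only in E (else K_{w+1}
  -- appears); then y may take colour m and x the old colour of y.
  module _ {w} (no-clique : ¬ HasClique G (suc w)) (E : List V)
    (E-clique : ∀ {e f} → e ∈ E → f ∈ E → e ≢ f → e ~ f) where

    P : List V → V → Set
    P S v = v ∈ S ⊎ v ∈ E

    module _ {S x y} (x∈ : x ∈ S) (y∈ : y ∈ S) (xy : x ~ y) (x-twin : Twins (_∈ S) x y) (y-twin : Twins (_∈ S) y x)
      (x∉E : ∀ {e} → e ∈ E → e ≢ x) (unique : ∀ {e f} → e ∈ E → f ∈ E → x ~ e → x ~ f → e ≡ f)
      (col : V → Fin w) (proper : Proper (λ v → P S v × v ≢ x) col) where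

      y≢x : y ≢ x
      y≢x = ~⇒≢ (~-sym xy)
      Nearˢ Nearᴱ : Fin w → V → Set
      Nearˢ m s = s ≢ x × s ~ x × col s ≡ m
      Nearᴱ m e = e ~ x × col e ≡ m
      nearˢ? : ∀ m → Dec (Any (Nearˢ m) S)
      nearˢ? m = Any.any? (λ s → ¬? (s Fin.≟ x) ×-dec (s ~? x) ×-dec (col s Fin.≟ m)) S
      nearᴱ? : ∀ m → Dec (Any (Nearᴱ m) E)
      nearᴱ? m = Any.any? (λ s → (s ~? x) ×-dec (col s Fin.≟ m)) E

      -- All `f m` other than `y` are common neighbours of the edge `xy`, hence pairwise adjacent;
      -- together with `x` they form a clique of size w + 1.
      no-rainbow : (f : Fin w → V) → (∀ m → f m ~ x) → (∀ m → f m ≢ y → f m ~ y) → (∀ m → col (f m) ≡ m) → ⊥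
      no-rainbow f fx fy f-col = no-clique (hasClique {f = x ◂ f} (clique-◂ (~-sym ∘ fx) f-clique))
        where
        f-clique : Clique f
        f-clique i j i≢j with f i Fin.≟ y | f j Fin.≟ y
        ... | no fi≢y | no fj≢y = diamond-free xy (fx i) (fy i fi≢y) (fx j) (fy j fj≢y)
              (λ eq → i≢j (trans (≡.sym (f-col i)) (trans (cong col eq) (f-col j))))
        ... | yes fi≡y | no fj≢y = subst (_~ f j) (≡.sym fi≡y) (~-sym (fy j fj≢y))
        ... | no fi≢y | yes fj≡y = subst (f i ~_) (≡.sym fj≡y) (fy i fi≢y)
        ... | yes fi≡y | yes fj≡y = contradiction
              (trans (≡.sym (f-col i)) (trans (cong col (trans fi≡y (≡.sym fj≡y))) (f-col j))) i≢j

      recoloured : ColourableOn (P S) w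
      recoloured with any? (λ m → ¬? (nearˢ? m) ×-dec ¬? (nearᴱ? m))
      ... | yes (m , noneˢ , noneᴱ) = col [ x ↦ m ] , recolour proper λ
        { (inj₁ u∈) u≢x ux eq → noneˢ (lose u∈ (u≢x , ux , eq))
        ; (inj₂ u∈) u≢x ux eq → noneᴱ (lose u∈ (ux , eq)) }
      ... | no all-near with any? (λ m → ¬? (nearˢ? m))
      ...   | no none-missing = ⊥-elim (no-rainbow (proj₁ ∘ near)
                  (λ m → proj₁ (proj₂ (proj₂ (proj₂ (near m)))))
                (λ m → x-twin (proj₁ (proj₂ (near m))) (proj₁ (proj₂ (proj₂ (proj₂ (near m))))))
                (λ m → proj₂ (proj₂ (proj₂ (proj₂ (near m))))))
        where
        near : ∀ m → ∃ λ s → s ∈ S × Nearˢ m s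
        near m = find (decidable-stable (nearˢ? m) λ missing → none-missing (m , missing))
      ...   | yes (m₀ , missing) with find (decidable-stable (nearᴱ? m₀) λ none → all-near (m₀ , missing , none))
      ...     | e , e∈ , ex , e-col with Any.any? (λ f → (f ~? y) ×-dec (col f Fin.≟ m₀)) E
      ...       | no y-free = col [ y ↦ m₀ ] [ x ↦ col y ] ,
          recolour (recolour (λ (hu , u≢) (hv , v≢) → proper hu hv) avoid-y) avoid-x
        where
        avoid-y : ∀ {u} → P S u × u ≢ x → u ≢ y → u ~ y → col u ≢ m₀
        avoid-y (inj₁ u∈ , u≢x) u≢y uy eq = missing (lose u∈ (u≢x , y-twin u∈ uy u≢x , eq))
        avoid-y (inj₂ u∈ , u≢x) u≢y uy eq = y-free (lose u∈ (uy , eq))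
        avoid-x : ∀ {u} → P S u → u ≢ x → u ~ x → (col [ y ↦ m₀ ]) u ≢ col y
        avoid-x {u} hu u≢x ux with u Fin.≟ y
        avoid-x {u} hu u≢x ux | yes refl = λ eq → missing (lose y∈ (y≢x , ux , ≡.sym eq))
        avoid-x {u} (inj₁ u∈) u≢x ux | no u≢y = proper (inj₁ u∈ , u≢x) (inj₁ y∈ , y≢x) (x-twin u∈ ux u≢y)
        -- The only neighbour of `x` in `E` is `e`, of colour `m₀`, and `y` does not have that
        -- colour because it is a neighbour of `x` in `S`.
        avoid-x {u} (inj₂ u∈) u≢x ux | no u≢y rewrite unique u∈ e∈ (~-sym ux) (~-sym ex) =
          λ eq → missing (lose y∈ (y≢x , ~-sym xy , trans (≡.sym eq) e-col))
      -- Vertices of the clique `E` with the same colour coincide, so `e` sees both `x` and `y`. It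
      -- supplies every colour missing from the neighbours of `x` in `S`, and a rainbow arises
      -- again.
      ...       | yes found with f , f∈ , fy , f-col ← find found =
        ⊥-elim (no-rainbow (proj₁ ∘ near) (proj₁ ∘ proj₂ ∘ near) (proj₁ ∘ proj₂ ∘ proj₂ ∘ near)
          (proj₂ ∘ proj₂ ∘ proj₂ ∘ near))
        where
        e≡f : e ≡ f
        e≡f with e Fin.≟ f
        ... | yes e≡f = e≡f
        ... | no e≢f  = contradiction (trans e-col (≡.sym f-col))
                (proper (inj₂ e∈ , x∉E e∈) (inj₂ f∈ , x∉E f∈) (E-clique e∈ f∈ e≢f))
        near : ∀ m → ∃ λ s → s ~ x × (s ≢ y → s ~ y) × col s ≡ m
        near m with nearˢ? m
        ... | yes found with s , s∈ , s≢x , sx , s-col ← find found = s , sx , x-twin s∈ sx , s-col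
        ... | no none with g , g∈ , gx , g-col ← find (decidable-stable (nearᴱ? m) λ noneᴱ → all-near (m , none , noneᴱ))
              rewrite unique g∈ e∈ (~-sym gx) (~-sym ex) = e , ex , (λ _ → subst (_~ y) (≡.sym e≡f) fy) , g-col

    colour-from-triangle-free : ∀ S → P4Free (_∈ S) → (∀ {s} → s ∈ S → s ∈ E → ⊥) →
      (∀ {s e f} → s ∈ S → e ∈ E → f ∈ E → s ~ e → s ~ f → e ≡ f) →
      (∀ S′ → (∀ {s} → s ∈ S′ → s ∈ S) → TriangleFree (_∈ S′) → ColourableOn (P S′) w) →
      ColourableOn (P S) w
    colour-from-triangle-free S₀ p4₀ disjoint₀ unique₀ base = ∖-induction _ step S₀ id
      where
      step : ∀ S → (∀ {x} → x ∈ S → (∀ {s} → s ∈ S ∖ x → s ∈ S₀) → ColourableOn (P (S ∖ x)) w) →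
        (∀ {s} → s ∈ S → s ∈ S₀) → ColourableOn (P S) w
      step S ih ⊆S₀ with triangle? S
      ... | inj₂ free = base S ⊆S₀ free
      ... | inj₁ (p , q , r , (p∈ , q∈ , r∈) , pq , qr , pr) =
        recoloured x∈ y∈ xy x-twin y-twin (λ { e∈ refl → disjoint₀ (⊆S₀ x∈) e∈ }) (unique₀ (⊆S₀ x∈))
          (proj₁ IH) (λ (hu , u≢) (hv , v≢) → proj₂ IH (shrink hu u≢) (shrink hv v≢))
        where
        open TwinTriangle (twin-triangle {R = _∈ S} (P4Free-⊆ ⊆S₀ p4₀) p∈ q∈ r∈ p∈ q∈ r∈ pq qr pr)
        IH = ih x∈ (⊆S₀ ∘ proj₁ ∘ ∈-∖⁻)
        shrink : ∀ {v} → P S v → v ≢ x → P (S ∖ x) v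
        shrink (inj₁ v∈) v≢ = inj₁ (∈-∖⁺ v∈ v≢)
        shrink (inj₂ v∈) v≢ = inj₂ v∈

  -- The reduction with `E` empty; it ends in a bipartite graph, for which two colours suffice.
  colour-P4Free : ∀ {c} → ¬ HasClique G (3 + c) → ∀ S → P4Free (_∈ S) → ColourableOn (_∈ S) (2 + c)
  colour-P4Free no-clique S p4 with col , proper ← colour-from-triangle-free no-clique [] (λ ()) S p4 (λ _ ()) (λ _ ())
      (λ S′ ⊆S free → let col , proper = colour-inject (s≤s (s≤s z≤n)) (colour-bipartite S′ (P4Free-⊆ ⊆S p4) free) in
        col , λ { (inj₁ a) (inj₁ b) → proper a b }) =
    col , λ a b → proper (inj₁ a) (inj₁ b)

-- From forbidden induced subgraphs to statements about edges

Symmetric : ∀ {k} → (Fin k → Fin k → Bool) → Set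
Symmetric h = ∀ i j → h i j ≡ h j i

symmetric? : ∀ {k} (h : Fin k → Fin k → Bool) → Dec (Symmetric h)
symmetric? h = all? λ i → all? λ j → h i j Bool.≟ h j i

module Induced (G : Graph) where

  open Adjacency G

  Matches : ∀ {k} → (Fin k → Fin k → Bool) → (Fin k → V) → Set
  Matches h f = ∀ i j → adj G (f i) (f j) ≡ h i j

  -- Only the entries above the diagonal are supplied by hand; symmetry of `h` gives the others.
  matches-◂ : ∀ {k} {h : Fin (suc k) → Fin (suc k) → Bool} {x f} → h zero zero ≡ false →
    (∀ j → adj G x (f j) ≡ h zero (suc j)) →
    (Symmetric (λ i j → h (suc i) (suc j)) → Matches (λ i j → h (suc i) (suc j)) f) →
    Symmetric h → Matches h (x ◂ f)
  matches-◂ h-irrefl row m s zero    zero    = trans (irrefl G _) (≡.sym h-irrefl)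
  matches-◂ h-irrefl row m s zero    (suc j) = row j
  matches-◂ h-irrefl row m s (suc i) zero    = trans (Graph.sym G _ _) (trans (row i) (s zero (suc i)))
  matches-◂ h-irrefl row m s (suc i) (suc j) = m (λ i j → s (suc i) (suc j)) i j

  P4-free-off-edge : ¬ InducedSub 6 P2∪P4 G → P4FreeOffEdges
  P4-free-off-edge none {u} {v} uv {a} {b} {c} {d} (a≁u , a≁v) (b≁u , b≁v) (c≁u , c≁v) (d≁u , d≁v)
    ab bc cd a≁c a≁d b≁d =
    none (f , (λ {i} {j} → injective i j) , matches)
    where
    f : Fin 6 → V
    f = u ◂ v ◂ a ◂ b ◂ c ◂ d ◂ ε
    matches : Matches P2∪P4 f
    matches =
      (matches-◂ refl
        (λ { 0F → uv ; 1F → ¬-not (≁-sym a≁u) ; 2F → ¬-not (≁-sym b≁u) ; 3F → ¬-not (≁-sym c≁u) ; 4F → ¬-not (≁-sym d≁u) })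
      (matches-◂ refl
        (λ { 0F → ¬-not (≁-sym a≁v) ; 1F → ¬-not (≁-sym b≁v) ; 2F → ¬-not (≁-sym c≁v) ; 3F → ¬-not (≁-sym d≁v) })
      (matches-◂ refl (λ { 0F → ab ; 1F → ¬-not a≁c ; 2F → ¬-not a≁d })
      (matches-◂ refl (λ { 0F → bc ; 1F → ¬-not b≁d })
      (matches-◂ refl (λ { 0F → cd })
      (matches-◂ {f = ε} refl (λ ()) λ _ ()))))))
      (from-yes (symmetric? P2∪P4))
    injective : ∀ i j → f i ≡ f j → i ≡ j
    -- No two vertices of P₂ ∪ P₄ have the same neighbourhood, so matching adjacencies force
    -- injectivity.
    injective i j eq = from-yes (all? λ i → all? λ j → (all? λ k → P2∪P4 i k Bool.≟ P2∪P4 j k) →-dec (i Fin.≟ j)) i j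
      λ k → trans (≡.sym (matches i k)) (trans (cong (λ v → adj G v (f k)) eq) (matches j k))

  adjacent-across-edge : ¬ InducedSub 4 diamond G → DiamondFree
  adjacent-across-edge none {p} {q} {x} {y} pq xp xq yp yq x≢y = ~-stable λ x≁y →
    let matches : Matches diamond f
        matches =
          (matches-◂ refl (λ { 0F → xp ; 1F → xq ; 2F → ¬-not x≁y })
          (matches-◂ refl (λ { 0F → pq ; 1F → ~-sym yp })
          (matches-◂ refl (λ { 0F → ~-sym yq })
          (matches-◂ {f = ε} refl (λ ()) λ _ ()))))
          (from-yes (symmetric? diamond))
    in none (f , (λ {i} {j} → injective matches i j) , matches)
    where
    f : Fin 4 → V
    f = x ◂ p ◂ q ◂ y ◂ ε
    injective : Matches diamond f → ∀ i j → f i ≡ f j → i ≡ j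
    -- 0 and 3 are the only nonadjacent pair of the diamond and are told apart by `x≢y`; adjacent
    -- vertices are distinct anyway.
    injective matches 0F 3F eq = contradiction eq x≢y
    injective matches 3F 0F eq = contradiction (≡.sym eq) x≢y
    injective matches i j eq with from-yes (all? λ i → all? λ j →
      (i Fin.≟ j) ⊎-dec (diamond i j Bool.≟ true) ⊎-dec
      ((i Fin.≟ 0F) ×-dec (j Fin.≟ 3F)) ⊎-dec ((i Fin.≟ 3F) ×-dec (j Fin.≟ 0F))) i j
    ... | inj₁ i≡j = i≡j
    ... | inj₂ (inj₁ ij) = contradiction eq (~⇒≢ (trans (matches i j) ij))
    ... | inj₂ (inj₂ (inj₁ (refl , refl))) = contradiction eq x≢y
    ... | inj₂ (inj₂ (inj₂ (refl , refl))) = contradiction (≡.sym eq) x≢y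

-- Clique numbers 2 and 3

module Free (G : Graph) (diamond-free : Adjacency.DiamondFree G)
            (off-edge : Adjacency.P4FreeOffEdges G) where

  open Adjacency G

  open Diamond-free G diamond-free

  Off : V → V → List V
  Off u v = filter (λ x → ¬? (x ~? u) ×-dec ¬? (x ~? v)) (allFin _)

  ∈-Off⁻ : ∀ {u v x} → x ∈ Off u v → x ≁ u × x ≁ v
  ∈-Off⁻ {u} {v} = proj₂ ∘ ∈-filter⁻ (λ x → ¬? (x ~? u) ×-dec ¬? (x ~? v)) {xs = allFin _}

  ∈-Off⁺ : ∀ {u v x} → x ≁ u → x ≁ v → x ∈ Off u v
  ∈-Off⁺ x≁u x≁v = ∈-filter⁺ _ (∈-allFin _) (x≁u , x≁v)

  Off-P4Free : ∀ {u v} → u ~ v → P4Free (_∈ Off u v)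
  Off-P4Free uv = P4Free-⊆ ∈-Off⁻ (off-edge uv)

  4-colourable : ¬ HasClique G 3 → ∀ {u v} → u ~ v → Colourable G 4
  4-colourable no-triangle {u} {v} uv = colourable everywhere
    (colour-∪ (_~? u) (colour-independent nbrs)
      (colour-∪ (_~? v) (colour-independent nbrs)
        (colour-bipartite (Off u v) (Off-P4Free uv) λ _ _ _ ab bc ac → no-triangle (triangle-clique ab bc ac))))
    where
    nbrs : ∀ {w x y} → x ~ w → y ~ w → x ≁ y
    nbrs xw yw xy = no-triangle (triangle-clique xy yw xw)
    everywhere : ∀ x → x ~ u ⊎ x ~ v ⊎ x ∈ Off u v
    everywhere x with x ~? u | x ~? v
    ... | yes xu | _      = inj₁ xu
    ... | no _   | yes xv = inj₂ (inj₁ xv)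
    ... | no x≁u | no x≁v = inj₂ (inj₂ (∈-Off⁺ x≁u x≁v))

  module _ (no-K4 : ¬ HasClique G 4) where

    -- The neighbourhood of u is a matching, so adding a single vertex creates no odd cycle
    -- unless that vertex sees both ends of a matching edge.
    colour-neighbourhood : ∀ u Z → (∀ {z z′} → z ∈ Z → z′ ∈ Z → z ≡ z′) → (∀ {z} → z ∈ Z → z ≢ u × z ≁ u) →
      ColourableOn (λ x → x ~ u ⊎ x ∈ Z) 2
    colour-neighbourhood u Z Z-single Z-off = col , proper
      where
      SeesZ Later : V → Set
      SeesZ x = Any (x ~_) Z
      -- A vertex of N(u) that does not see `Z` gets the second colour when its partner in the
      -- matching sees `Z` or has the larger index.
      Later x = ∃ λ y → y ~ u × y ~ x × (SeesZ y ⊎ x Fin.< y)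
      inZ? : ∀ x → Dec (Any (x ≡_) Z)
      inZ? x = Any.any? (x Fin.≟_) Z
      seesZ? : ∀ x → Dec (SeesZ x)
      seesZ? x = Any.any? (x ~?_) Z
      later? : ∀ x → Dec (Later x)
      later? x = any? λ y → (y ~? u) ×-dec (y ~? x) ×-dec (seesZ? y ⊎-dec (x Fin.<? y))
      col : V → Fin 2
      col x with inZ? x | seesZ? x | later? x
      ... | yes _ | _     | _     = 1F
      ... | no _  | yes _ | _     = 0F
      ... | no _  | no _  | yes _ = 1F
      ... | no _  | no _  | no _  = 0F
      -- Two partners of `x` would be common neighbours of the edge `xu`, hence adjacent, and give a
      -- K₄.
      partner-unique : ∀ {x y y′} → x ~ u → y ~ u → y′ ~ u → x ~ y → x ~ y′ → y ≡ y′
      partner-unique {y = y} {y′} xu yu y′u xy xy′ with y Fin.≟ y′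
      ... | yes y≡y′ = y≡y′
      ... | no y≢y′  = ⊥-elim (no-K4 (K4-clique {t = u} xy
              (diamond-free xu (~-sym xy) yu (~-sym xy′) y′u y≢y′) xy′ xu yu y′u))
      order : ∀ {x y} → x ~ u → y ~ u → x ~ y → ¬ SeesZ x → ¬ SeesZ y → Later x → ¬ Later y
      order xu yu xy x-blind y-blind (y′ , y′u , y′x , hy) (x′ , x′u , x′y , hx)
        with refl ← partner-unique xu yu y′u xy (~-sym y′x)
           | refl ← partner-unique yu xu x′u (~-sym xy) (~-sym x′y) with hx | hy
      ... | inj₁ sees | _         = x-blind sees
      ... | _         | inj₁ sees = y-blind sees
      ... | inj₂ y<x  | inj₂ x<y  = Fin.<-asym x<y y<x
      someone : ∀ {x y} → x ~ u → y ~ u → x ~ y → ¬ Later x → ¬ Later y → ⊥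
      someone {x} {y} xu yu xy ¬x ¬y with Fin.<-cmp x y
      ... | tri< x<y _ _ = ¬x (y , yu , ~-sym xy , inj₂ x<y)
      ... | tri≈ _ x≡y _ = ~⇒≢ xy x≡y
      ... | tri> _ _ y<x = ¬y (x , xu , xy , inj₂ y<x)
      proper : Proper (λ x → x ~ u ⊎ x ∈ Z) col
      proper {x} {y} hx hy xy with inZ? x | inZ? y
      ... | yes x∈ | yes y∈ = λ _ → ~⇒≢ xy (Z-single x∈ y∈)
      ... | yes x∈ | no y∉ with seesZ? y
      ...   | yes _ = λ ()
      ...   | no y-blind = λ _ → y-blind (lose x∈ (~-sym xy))
      proper {x} {y} hx hy xy | no x∉ | yes y∈ with seesZ? x
      ...   | yes _ = λ ()
      ...   | no x-blind = λ _ → x-blind (lose y∈ xy)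
      proper {x} {y} (inj₂ x∈) hy xy | no x∉ | no y∉ = contradiction x∈ x∉
      proper {x} {y} (inj₁ xu) (inj₂ y∈) xy | no x∉ | no y∉ = contradiction y∈ y∉
      proper {x} {y} (inj₁ xu) (inj₁ yu) xy | no x∉ | no y∉ with seesZ? x | seesZ? y | later? x | later? y
      -- Both ends see the same `z`; then `z` and `u` are common neighbours of the edge `xy`, hence
      -- adjacent, which is excluded.
      ... | yes sx | yes sy | _ | _ with z , z∈ , xz ← find sx | z′ , z′∈ , yz ← find sy with refl ← Z-single z∈ z′∈ =
        λ _ → proj₂ (Z-off z∈) (diamond-free xy (~-sym xz) (~-sym yz) (~-sym xu) (~-sym yu) (proj₁ (Z-off z∈)))
      ... | yes _  | no _   | _ | yes _ = λ ()
      ... | yes sx | no _   | _ | no ly = λ _ → ly (x , xu , xy , inj₁ sx)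
      ... | no _   | yes _  | yes _ | _ = λ ()
      ... | no _   | yes sy | no lx | _ = λ _ → lx (y , yu , ~-sym xy , inj₁ sy)
      ... | no _   | no _   | yes _ | no _ = λ ()
      ... | no _   | no _   | no _ | yes _ = λ ()
      ... | no bx  | no by  | yes lx | yes ly = λ _ → order xu yu xy bx by lx ly
      ... | no _   | no _   | no lx | no ly = λ _ → someone xu yu xy lx ly

    record Triangle : Set where
      field
        {x y z} : V
        xy : x ~ y
        yz : y ~ z
        xz : x ~ z

      On : V → Set
      On v = v ≡ x ⊎ v ≡ y ⊎ v ≡ z

      on-adjacent : ∀ {d e} → On d → On e → d ≢ e → d ~ e
      on-adjacent (inj₁ refl)        (inj₁ refl)        d≢e = contradiction refl d≢e
      on-adjacent (inj₁ refl)        (inj₂ (inj₁ refl)) d≢e = xy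
      on-adjacent (inj₁ refl)        (inj₂ (inj₂ refl)) d≢e = xz
      on-adjacent (inj₂ (inj₁ refl)) (inj₁ refl)        d≢e = ~-sym xy
      on-adjacent (inj₂ (inj₁ refl)) (inj₂ (inj₁ refl)) d≢e = contradiction refl d≢e
      on-adjacent (inj₂ (inj₁ refl)) (inj₂ (inj₂ refl)) d≢e = yz
      on-adjacent (inj₂ (inj₂ refl)) (inj₁ refl)        d≢e = ~-sym xz
      on-adjacent (inj₂ (inj₂ refl)) (inj₂ (inj₁ refl)) d≢e = ~-sym yz
      on-adjacent (inj₂ (inj₂ refl)) (inj₂ (inj₂ refl)) d≢e = contradiction refl d≢e

      -- By diamond-freeness an outside vertex with two neighbours in the triangle would see all of
      -- it, giving a K₄.
      one-neighbour : ∀ {v d e} → ¬ On v → On d → On e → d ≢ e → v ~ d → v ≁ e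
      one-neighbour {v} {d} {e} v∉ d∈ e∈ d≢e vd ve =
        no-K4 (K4-clique xy yz xz (all (inj₁ refl)) (all (inj₂ (inj₁ refl))) (all (inj₂ (inj₂ refl))))
        where
        all : ∀ {f} → On f → f ~ v
        all {f} f∈ with f Fin.≟ d | f Fin.≟ e
        ... | yes refl | _        = ~-sym vd
        ... | no _     | yes refl = ~-sym ve
        ... | no f≢d   | no f≢e   = diamond-free (on-adjacent d∈ e∈ d≢e) (on-adjacent f∈ d∈ f≢d) (on-adjacent f∈ e∈ f≢e)
              vd ve λ { refl → v∉ f∈ }

      missed-edge : ∀ {v} → ¬ On v → ∃ λ e → ∃ λ f → On e × On f × e ~ f × v ≁ e × v ≁ f
      missed-edge {v} v∉ with v ~? x | v ~? y
      ... | yes vx | _      = _ , _ , inj₂ (inj₁ refl) , inj₂ (inj₂ refl) , yz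
            , one-neighbour v∉ (inj₁ refl) (inj₂ (inj₁ refl)) (~⇒≢ xy) vx
            , one-neighbour v∉ (inj₁ refl) (inj₂ (inj₂ refl)) (~⇒≢ xz) vx
      ... | no v≁x | yes vy = _ , _ , inj₁ refl , inj₂ (inj₂ refl) , xz
            , v≁x , one-neighbour v∉ (inj₂ (inj₁ refl)) (inj₂ (inj₂ refl)) (~⇒≢ yz) vy
      ... | no v≁x | no v≁y = _ , _ , inj₁ refl , inj₂ (inj₁ refl) , xy , v≁x , v≁y

      another : ∀ d → ∃ λ e → On e × e ≢ d
      another d with x Fin.≟ d
      ... | yes refl = y , inj₂ (inj₁ refl) , ~⇒≢ (~-sym xy)
      ... | no x≢d   = x , inj₁ refl , x≢d

    open Triangle using (On)

    Apart : Triangle → Triangle → Set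
    Apart D D′ = ∀ {d e} → On D d → On D′ e → d ≁ e

    ⌊_⌋ : ∀ {S R} → TwinTriangle S R → Triangle
    ⌊ t ⌋ = record { TwinTriangle t }

    module _ {S : List V} {R} (t : TwinTriangle S R) where
      open TwinTriangle t

      -- Any further neighbour of `x` in `S` would also see its twin `y`, against `one-neighbour`.
      x-neighbours : ∀ {s} → s ∈ S → s ~ x → s ≡ y ⊎ s ≡ z
      x-neighbours {s} s∈ sx with s Fin.≟ y | s Fin.≟ z
      ... | yes s≡y | _       = inj₁ s≡y
      ... | no _    | yes s≡z = inj₂ s≡z
      ... | no s≢y  | no s≢z  = contradiction (~-sym (x-twin s∈ sx s≢y))
        (Triangle.one-neighbour ⌊ t ⌋ s∉ (inj₁ refl) (inj₂ (inj₁ refl)) (~⇒≢ xy) sx ∘ ~-sym)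
        where
        s∉ : ¬ On ⌊ t ⌋ s
        s∉ (inj₁ refl) = ~⇒≢ sx refl
        s∉ (inj₂ (inj₁ s≡y)) = s≢y s≡y
        s∉ (inj₂ (inj₂ s≡z)) = s≢z s≡z

    twin-flip : ∀ {S R} → TwinTriangle S R → TwinTriangle S R
    twin-flip t = record { x∈ = y∈ ; y∈ = x∈ ; z∈ = z∈ ; Rx = Ry ; Ry = Rx ; Rz = Rz
      ; xy = ~-sym xy ; yz = xz ; xz = yz ; x-twin = y-twin ; y-twin = x-twin }
      where open TwinTriangle t

    module _ {S : List V} {R} (p4 : P4Free (_∈ S)) (t : TwinTriangle S R) where
      open TwinTriangle t

      -- In `S` the vertex `x` sees only `y` and `z`. If `a` were `y`, then `b` and `c`, avoiding
      -- `z`, would both be `x`.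
      apart-x : ∀ (t : TwinTriangle S R) {a b c} → a ∈ S → b ∈ S → c ∈ S → a ~ b → b ~ c → a ~ c →
        a ≢ TwinTriangle.z t → b ≢ TwinTriangle.z t → c ≢ TwinTriangle.z t → a ≁ TwinTriangle.x t
      apart-x t a∈ b∈ c∈ ab bc ac a≢z b≢z c≢z ax with x-neighbours t a∈ ax
      ... | inj₂ a≡z = a≢z a≡z
      ... | inj₁ refl with x-neighbours (twin-flip t) b∈ (~-sym ab) | x-neighbours (twin-flip t) c∈ (~-sym ac)
      ...   | inj₁ refl | inj₁ refl = ~⇒≢ bc refl
      ...   | inj₂ b≡z  | _         = b≢z b≡z
      ...   | _         | inj₂ c≡z  = c≢z c≡z

      -- If `a` saw `z`, the path x, z, a, b would force `b` to see `z`, and likewise `c`; then a,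
      -- b, c, z would be a K₄.
      apart-z : ∀ {a b c} → a ∈ S → b ∈ S → c ∈ S → a ~ b → b ~ c → a ~ c → a ≢ z → b ≢ z → c ≢ z → a ≁ z
      apart-z {a} a∈ b∈ c∈ ab bc ac a≢z b≢z c≢z az =
        no-K4 (K4-clique ab bc ac az
          (second b∈ ab (apart-x t b∈ c∈ a∈ bc (~-sym ac) (~-sym ab) b≢z c≢z a≢z))
          (second c∈ ac (apart-x t c∈ a∈ b∈ (~-sym ac) ab (~-sym bc) c≢z a≢z b≢z)))
        where
        second : ∀ {b} → b ∈ S → a ~ b → b ≁ x → b ~ z
        second b∈′ ab′ b≁x = ~-stable λ b≁z → p4 x∈ z∈ a∈ b∈′ xz (~-sym az) ab′
          (≁-sym (apart-x t a∈ b∈ c∈ ab bc ac a≢z b≢z c≢z)) (≁-sym b≁x) (≁-sym b≁z)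

      away : ∀ {a b c d} → a ∈ S × a ≢ z → b ∈ S × b ≢ z → c ∈ S × c ≢ z →
        a ~ b → b ~ c → a ~ c → On ⌊ t ⌋ d → d ≁ a
      away (a∈ , a≢z) (b∈ , b≢z) (c∈ , c≢z) ab bc ac (inj₁ refl) =
        ≁-sym (apart-x t a∈ b∈ c∈ ab bc ac a≢z b≢z c≢z)
      away (a∈ , a≢z) (b∈ , b≢z) (c∈ , c≢z) ab bc ac (inj₂ (inj₁ refl)) =
        ≁-sym (apart-x (twin-flip t) a∈ b∈ c∈ ab bc ac a≢z b≢z c≢z)
      away (a∈ , a≢z) (b∈ , b≢z) (c∈ , c≢z) ab bc ac (inj₂ (inj₂ refl)) =
        ≁-sym (apart-z a∈ b∈ c∈ ab bc ac a≢z b≢z c≢z)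

      -- This makes the triangles found after successive deletions of third vertices `z` pairwise
      -- anticomplete.
      apart-from-twins : (D : Triangle) → (∀ {d} → On D d → d ∈ S × d ≢ z) → Apart ⌊ t ⌋ D
      apart-from-twins D inside d∈ (inj₁ refl)        = away (inside (inj₁ refl))
        (inside (inj₂ (inj₁ refl))) (inside (inj₂ (inj₂ refl))) xy′ yz′ xz′ d∈
        where open Triangle D renaming (xy to xy′; yz to yz′; xz to xz′)
      apart-from-twins D inside d∈ (inj₂ (inj₁ refl)) = away (inside (inj₂ (inj₁ refl)))
        (inside (inj₂ (inj₂ refl))) (inside (inj₁ refl)) yz′ (~-sym xz′) (~-sym xy′) d∈
        where open Triangle D renaming (xy to xy′; yz to yz′; xz to xz′)
      apart-from-twins D inside d∈ (inj₂ (inj₂ refl)) = away (inside (inj₂ (inj₂ refl)))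
        (inside (inj₁ refl)) (inside (inj₂ (inj₁ refl))) (~-sym xz′) xy′ (~-sym yz′) d∈
        where open Triangle D renaming (xy to xy′; yz to yz′; xz to xz′)

    module _ (D₁ D₂ D₃ : Triangle) (apart₁₂ : Apart D₁ D₂) (apart₁₃ : Apart D₁ D₃) (apart₂₃ : Apart D₂ D₃) where

      -- Otherwise d, d₁, v, d₂, with `d` another vertex of `D₁`, would be an induced P₄
      -- anticomplete to an edge of `D₃` that `v` misses.
      at-most-one-triangle : ∀ {v d₁ d₂} → On D₁ d₁ → On D₂ d₂ → v ~ d₁ → v ≁ d₂
      at-most-one-triangle {v} {d₁} {d₂} d₁∈ d₂∈ vd₁ vd₂
        with d , d∈ , d≢d₁ ← Triangle.another D₁ d₁
           | e , f , e∈ , f∈ , ef , v≁e , v≁f ← Triangle.missed-edge D₃ {v} (λ v∈ → apart₁₃ d₁∈ v∈ (~-sym vd₁)) =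
        off-edge ef (apart₁₃ d∈ e∈ , apart₁₃ d∈ f∈) (apart₁₃ d₁∈ e∈ , apart₁₃ d₁∈ f∈) (v≁e , v≁f)
          (apart₂₃ d₂∈ e∈ , apart₂₃ d₂∈ f∈) (Triangle.on-adjacent D₁ d∈ d₁∈ d≢d₁) (~-sym vd₁) vd₂
          (≁-sym (Triangle.one-neighbour D₁ (λ v∈ → apart₁₂ v∈ d₂∈ vd₂) d₁∈ d∈ (d≢d₁ ∘ ≡.sym) vd₁))
          (apart₁₂ d∈ d₂∈) (apart₁₂ d₁∈ d₂∈)

      open Triangle D₂ using () renaming (x to x₂; y to y₂; xy to xy₂)

      D₁⊆ : ∀ {d} → On D₁ d → d ∈ Off x₂ y₂
      D₁⊆ d∈ = ∈-Off⁺ (apart₁₂ d∈ (inj₁ refl)) (apart₁₂ d∈ (inj₂ (inj₁ refl)))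

      -- Two vertices of D₁ have no neighbours outside D₁, so G − D₁ is P₄-free.
      6-colourable-apart : Colourable G 6
      6-colourable-apart = colourable everywhere
        (colour-∪ (Fin._≟ x) single (colour-∪ (Fin._≟ y) single (colour-∪ (Fin._≟ z) single
          (colour-P4Free no-K4 L (P4Free-⊆ outside (off-edge xy))))))
        where
        open Triangle D₁ using () renaming (xy to pq; yz to qr; xz to pr)
        t : TwinTriangle (Off x₂ y₂) (On D₁)
        t = twin-triangle (Off-P4Free xy₂) (D₁⊆ (inj₁ refl)) (D₁⊆ (inj₂ (inj₁ refl))) (D₁⊆ (inj₂ (inj₂ refl)))
          (inj₁ refl) (inj₂ (inj₁ refl)) (inj₂ (inj₂ refl)) pq qr pr
        open TwinTriangle t
        L : List V
        L = allFin _ ∖ x ∖ y ∖ z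
        single : ∀ {w} → ColourableOn (_≡ w) 1
        single = colour-independent λ { refl refl ww → ~⇒≢ ww refl }
        -- A vertex that sees `D₁` sees nothing of `D₂`, so it lies off the edge `x₂y₂`, where `x`
        -- and `y` are twins.
        near-D₁ : ∀ {v d} → On D₁ d → v ~ d → v ∈ Off x₂ y₂
        near-D₁ d∈ vd = ∈-Off⁺ (at-most-one-triangle d∈ (inj₁ refl) vd) (at-most-one-triangle d∈ (inj₂ (inj₁ refl)) vd)
        outside : ∀ {v} → v ∈ L → v ≁ x × v ≁ y
        outside v∈ with v∈′ , v≢z ← ∈-∖⁻ {S = allFin _ ∖ x ∖ y} v∈ with v∈″ , v≢y ← ∈-∖⁻ {S = allFin _ ∖ x} v∈′
          with _ , v≢x ← ∈-∖⁻ {S = allFin _} v∈″ =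
          (λ vx → [ v≢y , v≢z ]′ (x-neighbours t (near-D₁ Rx vx) vx)) ,
          (λ vy → [ v≢x , v≢z ]′ (x-neighbours (twin-flip t) (near-D₁ Ry vy) vy))
        everywhere : ∀ v → v ≡ x ⊎ v ≡ y ⊎ v ≡ z ⊎ v ∈ L
        everywhere v with v Fin.≟ x | v Fin.≟ y | v Fin.≟ z
        ... | yes v≡x | _       | _       = inj₁ v≡x
        ... | no _    | yes v≡y | _       = inj₂ (inj₁ v≡y)
        ... | no _    | no _    | yes v≡z = inj₂ (inj₂ (inj₁ v≡z))
        ... | no v≢x  | no v≢y  | no v≢z  = inj₂ (inj₂ (inj₂ (∈-∖⁺ (∈-∖⁺ (∈-∖⁺ (∈-allFin v) v≢x) v≢y) v≢z)))

    6-colourable : ∀ {u v} → u ~ v → Colourable G 6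
    6-colourable {u} {v} uv = search
      where
      Q : List V
      Q = Off u v
      Single : List V → Set
      Single Z = ∀ {z z′} → z ∈ Z → z′ ∈ Z → z ≡ z′
      -- Two colours each go to N(u) with `Z₁`, to N(v) with `Z₂`, and to the bipartite remainder
      -- `S`.
      combine : ∀ S Z₁ Z₂ → Single Z₁ → Single Z₂ → (∀ {z} → z ∈ Z₁ → z ∈ Q) → (∀ {z} → z ∈ Z₂ → z ∈ Q) →
        (∀ {x} → x ∈ S → x ∈ Q) → TriangleFree (_∈ S) → (∀ {x} → x ∈ Q → x ∈ Z₁ ⊎ x ∈ Z₂ ⊎ x ∈ S) →
        Colourable G 6
      combine S Z₁ Z₂ single₁ single₂ Z₁⊆ Z₂⊆ S⊆ free cover = colourable everywhere
        (colour-∪ (λ x → (x ~? u) ⊎-dec Any.any? (x Fin.≟_) Z₁)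
          (colour-neighbourhood u Z₁ single₁ λ z∈ → let z≁u , z≁v = ∈-Off⁻ (Z₁⊆ z∈) in (λ { refl → z≁v uv }) , z≁u)
        (colour-∪ (λ x → (x ~? v) ⊎-dec Any.any? (x Fin.≟_) Z₂)
          (colour-neighbourhood v Z₂ single₂ λ z∈ → let z≁u , z≁v = ∈-Off⁻ (Z₂⊆ z∈) in (λ { refl → z≁u (~-sym uv) }) , z≁v)
          (colour-bipartite S (P4Free-⊆ S⊆ (Off-P4Free uv)) free)))
        where
        everywhere : ∀ x → (x ~ u ⊎ x ∈ Z₁) ⊎ (x ~ v ⊎ x ∈ Z₂) ⊎ x ∈ S
        everywhere x with x ~? u | x ~? v
        ... | yes xu | _      = inj₁ (inj₁ xu)
        ... | no _   | yes xv = inj₂ (inj₁ (inj₁ xv))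
        ... | no x≁u | no x≁v with cover (∈-Off⁺ x≁u x≁v)
        ...   | inj₁ x∈Z₁        = inj₁ (inj₂ x∈Z₁)
        ...   | inj₂ (inj₁ x∈Z₂) = inj₂ (inj₁ (inj₂ x∈Z₂))
        ...   | inj₂ (inj₂ x∈S)  = inj₂ (inj₂ x∈S)
      none : Single []
      none ()
      one : ∀ {z} → Single (z ∷ [])
      one (here refl) (here refl) = refl
      search : Colourable G 6
      search with triangle? Q
      ... | inj₂ free = combine Q [] [] none none (λ ()) (λ ()) id free (inj₂ ∘ inj₂)
      ... | inj₁ (_ , _ , _ , (p∈ , q∈ , r∈) , pq , qr , pr) =
        search₁ (twin-triangle (Off-P4Free uv) p∈ q∈ r∈ p∈ q∈ r∈ pq qr pr)
        where
        search₁ : TwinTriangle Q (_∈ Q) → Colourable G 6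
        search₁ t₁ = after-z₁
          where
          open TwinTriangle t₁ using () renaming (z to z₁; z∈ to z₁∈)
          Q₁ = Q ∖ z₁
          Q₁⊆ : ∀ {x} → x ∈ Q₁ → x ∈ Q
          Q₁⊆ = proj₁ ∘ ∈-∖⁻
          search₂ : TwinTriangle Q₁ (_∈ Q₁) → Colourable G 6
          search₂ t₂ = after-z₂
            where
            open TwinTriangle t₂ using () renaming (z to z₂; z∈ to z₂∈; x∈ to x₂∈; y∈ to y₂∈)
            Q₂⊆ : ∀ {x} → x ∈ Q₁ ∖ z₂ → x ∈ Q₁
            Q₂⊆ = proj₁ ∘ ∈-∖⁻
            after-z₂ : Colourable G 6
            after-z₂ with triangle? (Q₁ ∖ z₂)
            ... | inj₂ free = combine (Q₁ ∖ z₂) (z₁ ∷ []) (z₂ ∷ []) one one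
                  (λ { (here refl) → z₁∈ }) (λ { (here refl) → Q₁⊆ z₂∈ })
                  (Q₁⊆ ∘ Q₂⊆) free split
              where
              split : ∀ {x} → x ∈ Q → x ∈ z₁ ∷ [] ⊎ x ∈ z₂ ∷ [] ⊎ x ∈ Q₁ ∖ z₂
              split {x} x∈ with x Fin.≟ z₁ | x Fin.≟ z₂
              ... | yes x≡z₁ | _        = inj₁ (here x≡z₁)
              ... | no _     | yes x≡z₂ = inj₂ (inj₁ (here x≡z₂))
              ... | no x≢z₁  | no x≢z₂  = inj₂ (inj₂ (∈-∖⁺ (∈-∖⁺ x∈ x≢z₁) x≢z₂))
            ... | inj₁ (_ , _ , _ , (p∈ , q∈ , r∈) , pq , qr , pr) = 6-colourable-apart ⌊ t₁ ⌋ ⌊ t₂ ⌋ D₃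
                  (apart-from-twins (Off-P4Free uv) t₁ ⌊ t₂ ⌋ λ
                    { (inj₁ refl) → ∈-∖⁻ x₂∈ ; (inj₂ (inj₁ refl)) → ∈-∖⁻ y₂∈ ; (inj₂ (inj₂ refl)) → ∈-∖⁻ z₂∈ })
                  (apart-from-twins (Off-P4Free uv) t₁ D₃ λ
                    { (inj₁ refl) → ∈-∖⁻ (Q₂⊆ p∈) ; (inj₂ (inj₁ refl)) → ∈-∖⁻ (Q₂⊆ q∈)
                    ; (inj₂ (inj₂ refl)) → ∈-∖⁻ (Q₂⊆ r∈) })
                  (apart-from-twins (P4Free-⊆ Q₁⊆ (Off-P4Free uv)) t₂ D₃ λ
                    { (inj₁ refl) → ∈-∖⁻ p∈ ; (inj₂ (inj₁ refl)) → ∈-∖⁻ q∈ ; (inj₂ (inj₂ refl)) → ∈-∖⁻ r∈ })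
              where
              D₃ : Triangle
              D₃ = record { xy = pq ; yz = qr ; xz = pr }
          after-z₁ : Colourable G 6
          after-z₁ with triangle? Q₁
          ... | inj₂ free = combine Q₁ (z₁ ∷ []) [] one none (λ { (here refl) → z₁∈ }) (λ ()) Q₁⊆ free split
            where
            split : ∀ {x} → x ∈ Q → x ∈ z₁ ∷ [] ⊎ x ∈ [] ⊎ x ∈ Q₁
            split {x} x∈ with x Fin.≟ z₁
            ... | yes x≡z₁ = inj₁ (here x≡z₁)
            ... | no x≢z₁  = inj₂ (inj₂ (∈-∖⁺ x∈ x≢z₁))
          ... | inj₁ (_ , _ , _ , (p∈ , q∈ , r∈) , pq , qr , pr) =
            search₂ (twin-triangle (P4Free-⊆ Q₁⊆ (Off-P4Free uv)) p∈ q∈ r∈ p∈ q∈ r∈ pq qr pr)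

-- Clique number at least 4 with a P₄-free rest

module Large (G : Graph) (diamond-free : Adjacency.DiamondFree G) where

  open Adjacency G

  open Diamond-free G diamond-free

  module _ {k} (no-clique : ¬ HasClique G (5 + k)) (K : Fin (4 + k) → V) (K-clique : Clique K) where

    InK : V → Set
    InK v = ∃ λ i → v ≡ K i

    inK? : ∀ v → Dec (InK v)
    inK? v = any? λ i → v Fin.≟ K i

    H E : List V
    H = filter (¬? ∘ inK?) (allFin _)
    E = List.tabulate K

    H⁻ : ∀ {v} → v ∈ H → ¬ InK v
    H⁻ = proj₂ ∘ ∈-filter⁻ (¬? ∘ inK?) {xs = allFin _}

    -- By diamond-freeness a vertex off `K` with two neighbours in `K` would see all of `K` and
    -- enlarge it.
    neighbour-unique : ∀ {v} → v ∈ H → ∀ i j → v ~ K i → v ~ K j → i ≡ j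
    neighbour-unique {v} v∈ i j vi vj with i Fin.≟ j
    ... | yes i≡j = i≡j
    ... | no i≢j  = ⊥-elim (no-clique (hasClique {f = v ◂ K} (clique-◂ all K-clique)))
      where
      all : ∀ l → v ~ K l
      all l with l Fin.≟ i | l Fin.≟ j
      ... | yes refl | _        = vi
      ... | no _     | yes refl = vj
      ... | no l≢i   | no l≢j   = diamond-free (K-clique i j i≢j) vi vj (K-clique l i l≢i) (K-clique l j l≢j)
            (λ v≡ → H⁻ v∈ (l , v≡))

    -- The vertex `K i` has colour i. One side uses the colours 0 and 1, the other 2 and 3; as a
    -- vertex off `K` sees at most one vertex of `K`, one of its two colours is available.
    colour-over-bipartite : ∀ {S} → (∀ {s} → s ∈ S → s ∈ H) → ColourableOn (_∈ S) 2 →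
      ColourableOn (λ v → v ∈ S ⊎ v ∈ E) (4 + k)
    colour-over-bipartite {S} ⊆H (side , side-proper) = col , proper
      where
      pick : ∀ (i : Fin 2) {A B : Set} → Dec A → Dec B → Fin (4 + k)
      pick 0F (yes _) _ = 1F
      pick 0F (no _)  _ = 0F
      pick 1F _ (yes _) = 3F
      pick 1F _ (no _)  = 2F
      col : V → Fin (4 + k)
      col v with inK? v
      ... | yes (i , _) = i
      ... | no _        = pick (side v) (v ~? K 0F) (v ~? K 2F)
      avoids : ∀ {v} i → v ∈ H → v ~ K i → ∀ c → pick c (v ~? K 0F) (v ~? K 2F) ≢ i
      avoids {v} i v∈ vi 0F eq with v ~? K 0F
      avoids 1F v∈ vi 0F refl | yes v0 = contradiction (neighbour-unique v∈ 1F 0F vi v0) λ ()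
      avoids 0F v∈ vi 0F refl | no v≁0 = v≁0 vi
      avoids {v} i v∈ vi 1F eq with v ~? K 2F
      avoids 3F v∈ vi 1F refl | yes v2 = contradiction (neighbour-unique v∈ 3F 2F vi v2) λ ()
      avoids 2F v∈ vi 1F refl | no v≁2 = v≁2 vi
      sides-differ : ∀ i j → i ≢ j → ∀ {A B C D : Set} (a : Dec A) (b : Dec B) (c : Dec C) (d : Dec D) →
        pick i a b ≢ pick j c d
      sides-differ 0F 0F i≢j _ _ _ _ = contradiction refl i≢j
      sides-differ 1F 1F i≢j _ _ _ _ = contradiction refl i≢j
      sides-differ 0F 1F _ (yes _) _ _ (yes _) ()
      sides-differ 0F 1F _ (yes _) _ _ (no _)  ()
      sides-differ 0F 1F _ (no _)  _ _ (yes _) ()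
      sides-differ 0F 1F _ (no _)  _ _ (no _)  ()
      sides-differ 1F 0F _ _ (yes _) (yes _) _ ()
      sides-differ 1F 0F _ _ (yes _) (no _)  _ ()
      sides-differ 1F 0F _ _ (no _)  (yes _) _ ()
      sides-differ 1F 0F _ _ (no _)  (no _)  _ ()
      in-S : ∀ {v} → v ∈ S ⊎ v ∈ E → ¬ InK v → v ∈ S
      in-S (inj₁ v∈) _ = v∈
      in-S (inj₂ v∈) v∉ = contradiction (∈-tabulate⁻ v∈) v∉
      proper : Proper (λ v → v ∈ S ⊎ v ∈ E) col
      proper {u} {v} hu hv uv with inK? u | inK? v
      ... | yes (i , refl) | yes (j , refl) = λ { refl → ~⇒≢ uv refl }
      ... | yes (i , refl) | no v∉ = avoids i (⊆H (in-S hv v∉)) (~-sym uv) (side v) ∘ ≡.sym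
      ... | no u∉ | yes (j , refl) = avoids j (⊆H (in-S hu u∉)) uv (side u)
      ... | no u∉ | no v∉ = sides-differ _ _ (side-proper (in-S hu u∉) (in-S hv v∉) uv) _ _ _ _

    colourable-off-P4 : P4Free (_∈ H) → Colourable G (4 + k)
    colourable-off-P4 p4 = colourable everywhere
      (colour-from-triangle-free no-clique E E-clique H p4
        (λ v∈H v∈E → H⁻ v∈H (∈-tabulate⁻ v∈E)) unique
        λ S ⊆H free → colour-over-bipartite ⊆H (colour-bipartite S (P4Free-⊆ ⊆H p4) free))
      where
      E-clique : ∀ {e f} → e ∈ E → f ∈ E → e ≢ f → e ~ f
      E-clique e∈ f∈ e≢f with i , refl ← ∈-tabulate⁻ {f = K} e∈ | j , refl ← ∈-tabulate⁻ {f = K} f∈ =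
        K-clique i j (e≢f ∘ cong K)
      unique : ∀ {s e f} → s ∈ H → e ∈ E → f ∈ E → s ~ e → s ~ f → e ≡ f
      unique s∈ e∈ f∈ se sf with i , refl ← ∈-tabulate⁻ {f = K} e∈ | j , refl ← ∈-tabulate⁻ {f = K} f∈ =
        cong K (neighbour-unique s∈ i j se sf)
      everywhere : ∀ v → v ∈ H ⊎ v ∈ E
      everywhere v with inK? v
      ... | yes (i , refl) = inj₂ (∈-tabulate⁺ {f = K} i)
      ... | no v∉          = inj₁ (∈-filter⁺ _ (∈-allFin v) v∉)

-- The patterns formed by a clique and a P₄ off it

isLabel : ∀ {s} → Fin (suc s) → Fin s → Bool
isLabel l i = does (l Fin.≟ suc i)

complete : ∀ s → Pattern s
complete zero    = []
complete (suc s) = replicate s true ▸ complete s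

framed : ∀ {s} → Vec (Vec Bool s) 4 → Pattern (4 + s)
framed (a ∷ b ∷ c ∷ d ∷ []) =
  (true ∷ false ∷ false ∷ a) ▸ (true ∷ false ∷ b) ▸ (true ∷ c) ▸ d ▸ complete _

-- For the vertices of a P₄, their neighbour in an s-clique: zero for none, suc i for the i-th.
Labels : ℕ → Set
Labels s = Vec (Fin (suc s)) 4

base : ∀ {s} → Labels s → Pattern (4 + s)
base ls = framed (map (λ l → tabulate (isLabel l)) ls)

-- If `i` does not occur, the last entry moves instead. This needs no correctness proof, as `Fits`
-- checks the arrangements.
to-front : ∀ {s m} → Fin s → Vec (Fin s) m → Vec (Fin s) m
to-front i []           = []
to-front i (j ∷ [])     = j ∷ []
to-front i (j ∷ js@(_ ∷ _)) with does (i Fin.≟ j) | to-front i js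
... | true  | _       = j ∷ js
... | false | i′ ∷ js′ = i′ ∷ j ∷ js′

-- The clique reordered by first occurrence among the labels.
arrangement : ∀ {s m} → Vec (Fin (suc s)) m → Vec (Fin s) s
arrangement []           = Vec.allFin _
arrangement (zero ∷ ls)  = arrangement ls
arrangement (suc i ∷ ls) = to-front i (arrangement ls)

-- Stated on the rows themselves, the form in which `framed` takes them.
Fits : ∀ {s} → Labels s → Labels s → Vec (Fin s) s → Set
Fits ls cs σ = AllPairs _≢_ σ × map (λ l → map (isLabel l) σ) ls ≡ map (λ c → tabulate (isLabel c)) cs

fits? : ∀ {s} (ls cs : Labels s) σ → Dec (Fits ls cs σ)
fits? ls cs σ = allPairs? (λ i j → ¬? (i Fin.≟ j)) σ ×-dec ≡-dec (≡-dec Bool._≟_) _ _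

-- Two clique vertices unseen by the P₄ would complete it to an induced P₂ ∪ P₄.
Missing : ∀ {s} → Labels s → Set
Missing ls = ∃ λ i → ∃ λ j → i ≢ j × VAll (λ l → l ≢ suc i × l ≢ suc j) ls

missing? : ∀ {s} (ls : Labels s) → Dec (Missing ls)
missing? ls = any? λ i → any? λ j → ¬? (i Fin.≟ j) ×-dec
  VAll.all? (λ l → ¬? (l Fin.≟ suc i) ×-dec ¬? (l Fin.≟ suc j)) ls

Listed : ∀ {s} → List (Labels s) → Labels s → Set
Listed css ls = Any (λ cs → Fits ls cs (arrangement ls) ⊎ Fits (reverse ls) cs (arrangement (reverse ls))) css

Exhaustive : ∀ {s} → List (Labels s) → Set
Exhaustive css = ∀ a b c d → let ls = a ∷ b ∷ c ∷ d ∷ [] in Missing ls ⊎ Listed css ls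

exhaustive? : ∀ {s} (css : List (Labels s)) → Dec (Exhaustive css)
exhaustive? css = all? λ a → all? λ b → all? λ c → all? λ d → exhausted? (a ∷ b ∷ c ∷ d ∷ [])
  where
  exhausted? : ∀ ls → Dec (Missing ls ⊎ Listed css ls)
  exhausted? ls = missing? ls ⊎-dec
    Any.any? (λ cs → fits? ls cs (arrangement ls) ⊎-dec fits? (reverse ls) cs (arrangement (reverse ls))) css

restrict : ∀ {k m} → (Fin k → Fin k → Bool) → Vec (Fin k) m → Pattern m
restrict h []       = []
restrict h (x ∷ xs) = map (h x) xs ▸ restrict h xs

root : ∀ {k m} → (Fin k → Fin k → Bool) → Fin k → Fin k → Vec (Fin k) m → Rooted
root h x y zs = rooted (map (h x) zs) (map (h y) zs) (restrict h zs)

-- The adjacency of the complete graph on k vertices.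
distinct : ∀ k → Fin k → Fin k → Bool
distinct k i j = not (does (i Fin.≟ j))

-- Every edge of the diamond, of K_{c+2} and of P₂ ∪ P₄, up to automorphism, is the edge
-- between the first two vertices of one of these orderings.
forbidden : ℕ → List Rooted
forbidden c =
    root diamond 1F 2F (0F ∷ 3F ∷ [])
  ∷ root diamond 1F 0F (2F ∷ 3F ∷ [])
  ∷ root diamond 0F 1F (2F ∷ 3F ∷ [])
  ∷ root (distinct (2 + c)) 0F 1F (tabulate {n = c} λ i → suc (suc i))
  ∷ root P2∪P4 0F 1F (2F ∷ 3F ∷ 4F ∷ 5F ∷ [])
  ∷ root P2∪P4 2F 3F (0F ∷ 1F ∷ 4F ∷ 5F ∷ [])
  ∷ root P2∪P4 3F 2F (0F ∷ 1F ∷ 4F ∷ 5F ∷ [])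
  ∷ root P2∪P4 3F 4F (0F ∷ 1F ∷ 2F ∷ 5F ∷ [])
  ∷ []

-- The colour tables, and the completeness of the list of patterns

record Entry (s c : ℕ) : Set where
  constructor entry
  field
    labels   : Labels s
    table    : Plan c
    verified : Search.Verified (forbidden c) (base labels) table

-- The tables were found by computer search; the digits are the labels of the P₄.
plan-0123 : Plan 3
plan-0123 = plan
  ( (21 ∷ 64 ∷ 68 ∷ 112 ∷ [])
  ∷ (66 ∷ 70 ∷ 130 ∷ 212 ∷ [])
  ∷ (0 ∷ 2 ∷ 16 ∷ 18 ∷ 34 ∷ 42 ∷ 184 ∷ [])
  ∷ [])
  ( ( 6
    , (43 ∷ 368 ∷ [])
    ∷ (68 ∷ 85 ∷ 224 ∷ [])
    ∷ (13 ∷ 141 ∷ 260 ∷ 269 ∷ 276 ∷ 452 ∷ [])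
    ∷ [])
  ∷ [])

entry-0123 : Entry 4 3
entry-0123 = entry (0F ∷ 1F ∷ 2F ∷ 3F ∷ []) plan-0123 (Search.evaluated refl)

plan-1023 : Plan 3
plan-1023 = plan
  ( (70 ∷ 131 ∷ 133 ∷ 141 ∷ 212 ∷ [])
  ∷ (0 ∷ 6 ∷ 16 ∷ 18 ∷ 134 ∷ 184 ∷ [])
  ∷ (5 ∷ 21 ∷ 37 ∷ 64 ∷ 68 ∷ 69 ∷ 112 ∷ [])
  ∷ [])
  ( ( 22
    , (11 ∷ 259 ∷ 275 ∷ 368 ∷ [])
    ∷ (13 ∷ 141 ∷ 269 ∷ 424 ∷ [])
    ∷ (84 ∷ 85 ∷ 86 ∷ 276 ∷ 451 ∷ [])
    ∷ [])
  ∷ [])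

entry-1023 : Entry 4 3
entry-1023 = entry (1F ∷ 0F ∷ 2F ∷ 3F ∷ []) plan-1023 (Search.evaluated refl)

plan-1123 : Plan 3
plan-1123 = plan
  ( (27 ∷ 70 ∷ 72 ∷ 112 ∷ [])
  ∷ (21 ∷ 129 ∷ 133 ∷ 137 ∷ 141 ∷ 212 ∷ [])
  ∷ (0 ∷ 2 ∷ 16 ∷ 18 ∷ 34 ∷ 42 ∷ 138 ∷ 184 ∷ [])
  ∷ [])
  []

entry-1123 : Entry 4 3
entry-1123 = entry (1F ∷ 1F ∷ 2F ∷ 3F ∷ []) plan-1123 (Search.evaluated refl)

plan-1213 : Plan 3
plan-1213 = plan
  ( (13 ∷ 37 ∷ 45 ∷ 133 ∷ 141 ∷ 229 ∷ [])
  ∷ (64 ∷ 65 ∷ 66 ∷ 67 ∷ 68 ∷ 70 ∷ 112 ∷ [])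
  ∷ (26 ∷ 74 ∷ 136 ∷ 137 ∷ 138 ∷ 139 ∷ 210 ∷ [])
  ∷ [])
  ( ( 26
    , (64 ∷ 75 ∷ 137 ∷ 267 ∷ 459 ∷ [])
    ∷ (32 ∷ 36 ∷ 84 ∷ 260 ∷ 261 ∷ 268 ∷ 368 ∷ [])
    ∷ (272 ∷ 273 ∷ 274 ∷ 275 ∷ 276 ∷ 278 ∷ 280 ∷ 282 ∷ 420 ∷ [])
    ∷ [])
  ∷ ( 10
    , (137 ∷ 261 ∷ 420 ∷ [])
    ∷ (276 ∷ 278 ∷ 368 ∷ [])
    ∷ (0 ∷ 20 ∷ 32 ∷ 36 ∷ 52 ∷ 84 ∷ 128 ∷ 148 ∷ 224 ∷ [])
    ∷ [])
  ∷ ( 34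
    , (85 ∷ 224 ∷ [])
    ∷ (0 ∷ 4 ∷ 36 ∷ 52 ∷ 64 ∷ 68 ∷ 368 ∷ [])
    ∷ (75 ∷ 267 ∷ 273 ∷ 275 ∷ 281 ∷ 283 ∷ 458 ∷ [])
    ∷ [])
  ∷ ( 140
    , (74 ∷ 137 ∷ 458 ∷ [])
    ∷ (0 ∷ 20 ∷ 36 ∷ 52 ∷ 148 ∷ 280 ∷ 420 ∷ [])
    ∷ (27 ∷ 69 ∷ 91 ∷ 129 ∷ 131 ∷ 133 ∷ 135 ∷ 225 ∷ [])
    ∷ [])
  ∷ [])

entry-1213 : Entry 4 3
entry-1213 = entry (1F ∷ 2F ∷ 1F ∷ 3F ∷ []) plan-1213 (Search.evaluated refl)

plan-1223 : Plan 3
plan-1223 = plan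
  ( (37 ∷ 64 ∷ 68 ∷ 69 ∷ 112 ∷ [])
  ∷ (0 ∷ 16 ∷ 18 ∷ 26 ∷ 32 ∷ 38 ∷ 184 ∷ [])
  ∷ (5 ∷ 13 ∷ 21 ∷ 29 ∷ 129 ∷ 131 ∷ 133 ∷ 141 ∷ 214 ∷ [])
  ∷ [])
  ( ( 140
    , (74 ∷ 137 ∷ 225 ∷ [])
    ∷ (85 ∷ 129 ∷ 150 ∷ 450 ∷ [])
    ∷ (27 ∷ 37 ∷ 59 ∷ 263 ∷ 368 ∷ [])
    ∷ [])
  ∷ [])

entry-1223 : Entry 4 3
entry-1223 = entry (1F ∷ 2F ∷ 2F ∷ 3F ∷ []) plan-1223 (Search.evaluated refl)

plan-1231 : Plan 3
plan-1231 = plan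
  ( (65 ∷ 66 ∷ 67 ∷ 74 ∷ 130 ∷ 210 ∷ [])
  ∷ (133 ∷ 137 ∷ 138 ∷ 139 ∷ 141 ∷ 180 ∷ [])
  ∷ (0 ∷ 2 ∷ 4 ∷ 16 ∷ 18 ∷ 20 ∷ 22 ∷ 34 ∷ 112 ∷ [])
  ∷ [])
  ( ( 37
    , (266 ∷ 274 ∷ 275 ∷ 278 ∷ 282 ∷ 360 ∷ [])
    ∷ (5 ∷ 37 ∷ 133 ∷ 149 ∷ 261 ∷ 277 ∷ 421 ∷ [])
    ∷ (64 ∷ 72 ∷ 80 ∷ 88 ∷ 264 ∷ 265 ∷ 268 ∷ 466 ∷ [])
    ∷ [])
  ∷ ( 6
    , (75 ∷ 275 ∷ 466 ∷ [])
    ∷ (132 ∷ 149 ∷ 224 ∷ [])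
    ∷ (13 ∷ 45 ∷ 269 ∷ 420 ∷ [])
    ∷ [])
  ∷ ( 74
    , (274 ∷ 275 ∷ 276 ∷ 278 ∷ 282 ∷ 420 ∷ [])
    ∷ (9 ∷ 41 ∷ 73 ∷ 75 ∷ 265 ∷ 267 ∷ 361 ∷ [])
    ∷ (128 ∷ 130 ∷ 132 ∷ 134 ∷ 260 ∷ 261 ∷ 268 ∷ 466 ∷ [])
    ∷ [])
  ∷ ( 134
    , (33 ∷ 131 ∷ 149 ∷ 260 ∷ 276 ∷ 420 ∷ [])
    ∷ (13 ∷ 45 ∷ 74 ∷ 132 ∷ 148 ∷ 225 ∷ [])
    ∷ (0 ∷ 4 ∷ 8 ∷ 32 ∷ 36 ∷ 40 ∷ 72 ∷ 268 ∷ 360 ∷ [])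
    ∷ [])
  ∷ [])

entry-1231 : Entry 4 3
entry-1231 = entry (1F ∷ 2F ∷ 3F ∷ 1F ∷ []) plan-1231 (Search.evaluated refl)

plan-1234 : Plan 3
plan-1234 = plan
  ( (128 ∷ 130 ∷ 132 ∷ 133 ∷ 134 ∷ 180 ∷ [])
  ∷ (0 ∷ 4 ∷ 16 ∷ 18 ∷ 20 ∷ 22 ∷ 26 ∷ 210 ∷ [])
  ∷ (5 ∷ 9 ∷ 13 ∷ 25 ∷ 29 ∷ 33 ∷ 36 ∷ 37 ∷ 41 ∷ 45 ∷ 69 ∷ 120 ∷ [])
  ∷ [])
  ( ( 138
    , (37 ∷ 84 ∷ 148 ∷ 150 ∷ 241 ∷ [])
    ∷ (73 ∷ 139 ∷ 144 ∷ 146 ∷ 275 ∷ 450 ∷ [])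
    ∷ (9 ∷ 33 ∷ 41 ∷ 42 ∷ 67 ∷ 75 ∷ 265 ∷ 360 ∷ [])
    ∷ [])
  ∷ ( 21
    , (51 ∷ 66 ∷ 82 ∷ 138 ∷ 240 ∷ [])
    ∷ (85 ∷ 133 ∷ 145 ∷ 149 ∷ 276 ∷ 451 ∷ [])
    ∷ (0 ∷ 10 ∷ 32 ∷ 42 ∷ 74 ∷ 90 ∷ 266 ∷ 360 ∷ [])
    ∷ [])
  ∷ ( 6
    , (45 ∷ 269 ∷ 420 ∷ [])
    ∷ (132 ∷ 145 ∷ 149 ∷ 240 ∷ [])
    ∷ (67 ∷ 75 ∷ 264 ∷ 266 ∷ 450 ∷ [])
    ∷ [])
  ∷ [])

entry-1234 : Entry 4 3
entry-1234 = entry (1F ∷ 2F ∷ 3F ∷ 4F ∷ []) plan-1234 (Search.evaluated refl)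

plan₅-1234 : Plan 4
plan₅-1234 = plan
  ( (22 ∷ 466 ∷ [])
  ∷ (134 ∷ 240 ∷ [])
  ∷ (37 ∷ 128 ∷ 132 ∷ 481 ∷ [])
  ∷ (0 ∷ 16 ∷ 18 ∷ 74 ∷ 376 ∷ [])
  ∷ [])
  []

entry₅-1234 : Entry 5 4
entry₅-1234 = entry (1F ∷ 2F ∷ 3F ∷ 4F ∷ []) plan₅-1234 (Search.evaluated refl)

entries₄ : List (Entry 4 3)
entries₄ =
    entry-0123
  ∷ entry-1023
  ∷ entry-1123
  ∷ entry-1213
  ∷ entry-1223
  ∷ entry-1231
  ∷ entry-1234
  ∷ []

entries₅ : List (Entry 5 4)
entries₅ =
    entry₅-1234
  ∷ []

-- At most one of the four clique vertices is unseen, so three different nonzero labels occur. Up to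
-- renaming the clique and reversing the P₄ this leaves seven sequences.
exhaustive₄ : Exhaustive (List.map Entry.labels entries₄)
exhaustive₄ = holds (exhaustive? _) refl

-- At most one of the five clique vertices is unseen, so the four labels are nonzero and distinct.
exhaustive₅ : Exhaustive (List.map Entry.labels entries₅)
exhaustive₅ = holds (exhaustive? _) refl

-- Four labels always leave two of six clique vertices unseen.
exhaustive₆ : Exhaustive {6} []
exhaustive₆ = holds (exhaustive? _) refl

-- Clique number at least 4: colouring around a P₄

module _ (G : Graph) where

  open Adjacency G

  module _ {k} (h : Fin k → Fin k → Bool) (p : Pattern k) (π : Vec (Fin k) k) where

    -- That is, `π` is an isomorphism from `h` onto the pattern `p`.
    Represents : Set
    Represents = (∀ i j → edge p (lookup π i) (lookup π j) ≡ h i j) × (∀ i j → lookup π i ≡ lookup π j → i ≡ j)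

    represents? : Dec Represents
    represents? = (all? λ i → all? λ j → edge p (lookup π i) (lookup π j) Bool.≟ h i j)
      ×-dec (all? λ i → all? λ j → (lookup π i Fin.≟ lookup π j) →-dec (i Fin.≟ j))

    no-copy : Represents → ¬ InducedSub k h G → ∀ vs → ¬ Copy (adj G) vs p
    no-copy (edges , injective) none vs c = none (f , (λ {i} {j} → f-injective i j) ,
      λ i j → trans (copy-edge (Graph.sym G) (irrefl G) c _ _) (edges i j))
      where
      f : Fin k → V
      f i = lookup vs (lookup π i)
      f-injective : ∀ i j → f i ≡ f j → i ≡ j
      f-injective i j eq with lookup π i Fin.≟ lookup π j
      ... | yes πi≡πj = injective i j πi≡πj
      ... | no πi≢πj  = contradiction eq (copy-distinct (Graph.sym G) (irrefl G) c _ _ πi≢πj)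

  no-distinct : ∀ {k} → ¬ HasClique G k → ¬ InducedSub k (distinct k) G
  no-distinct none (f , f-injective , f-edges) = none (f , f-injective , λ i j i≢j → trans (f-edges i j) (lemma i j i≢j))
    where
    lemma : ∀ i j → i ≢ j → distinct _ i j ≡ true
    lemma i j i≢j with i Fin.≟ j
    ... | yes i≡j = contradiction i≡j i≢j
    ... | no _    = refl

  -- Here `π` sends each vertex of `h` to its position in the ordering x, y, zs.
  no-root : ∀ {m} (h : Fin (2 + m) → Fin (2 + m) → Bool) x y zs π
    {_ : True (represents? h (whole (root h x y zs)) π)} →
    ¬ InducedSub (2 + m) h G → ∀ vs → ¬ Copy (adj G) vs (whole (root h x y zs))
  no-root h x y zs π {represents} = no-copy h _ π (toWitness represents)

  module _ (no-P2∪P4 : ¬ InducedSub 6 P2∪P4 G) (no-diamond : ¬ InducedSub 4 diamond G) where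

    -- For a variable `c` the check for the complete graph does not evaluate; the implicit argument
    -- defers it to the uses with c = 3 and c = 4.
    forbidden-absent : ∀ c
      {_ : True (represents? (distinct (2 + c)) (whole (root (distinct (2 + c)) 0F 1F (tabulate {n = c} λ i → suc (suc i))))
                             (Vec.allFin _))} →
      ¬ HasClique G (2 + c) → All (λ F → ∀ vs → ¬ Copy (adj G) vs (whole F)) (forbidden c)
    forbidden-absent c {clique} no-clique =
        no-root diamond 1F 2F (0F ∷ 3F ∷ []) (2F ∷ 0F ∷ 1F ∷ 3F ∷ []) no-diamond
      ∷ no-root diamond 1F 0F (2F ∷ 3F ∷ []) (1F ∷ 0F ∷ 2F ∷ 3F ∷ []) no-diamond
      ∷ no-root diamond 0F 1F (2F ∷ 3F ∷ []) (0F ∷ 1F ∷ 2F ∷ 3F ∷ []) no-diamond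
      ∷ no-root (distinct (2 + c)) 0F 1F (tabulate {n = c} λ i → suc (suc i)) (Vec.allFin _) {clique} (no-distinct no-clique)
      ∷ no-root P2∪P4 0F 1F (2F ∷ 3F ∷ 4F ∷ 5F ∷ []) (0F ∷ 1F ∷ 2F ∷ 3F ∷ 4F ∷ 5F ∷ []) no-P2∪P4
      ∷ no-root P2∪P4 2F 3F (0F ∷ 1F ∷ 4F ∷ 5F ∷ []) (2F ∷ 3F ∷ 0F ∷ 1F ∷ 4F ∷ 5F ∷ []) no-P2∪P4
      ∷ no-root P2∪P4 3F 2F (0F ∷ 1F ∷ 4F ∷ 5F ∷ []) (2F ∷ 3F ∷ 1F ∷ 0F ∷ 4F ∷ 5F ∷ []) no-P2∪P4
      ∷ no-root P2∪P4 3F 4F (0F ∷ 1F ∷ 2F ∷ 5F ∷ []) (2F ∷ 3F ∷ 4F ∷ 0F ∷ 1F ∷ 5F ∷ []) no-P2∪P4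
      ∷ []

  LabelledBy : ∀ {s} → (Fin s → V) → V → Fin (suc s) → Set
  LabelledBy κ v l = ∀ i → adj G v (κ i) ≡ isLabel l i

  has-label : ∀ {s} (κ : Fin s → V) v → (∀ i j → v ~ κ i → v ~ κ j → i ≡ j) → ∃ (LabelledBy κ v)
  has-label κ v unique with any? (λ i → v ~? κ i)
  ... | no none = zero , λ i → ¬-not λ vi → none (i , vi)
  ... | yes (i , vi) = suc i , by
    where
    by : LabelledBy κ v (suc i)
    by j with i Fin.≟ j
    ... | yes refl = vi
    ... | no i≢j   = ¬-not λ vj → i≢j (unique i j vi vj)

  record Off-clique {s} (κ : Fin s → V) (v : V) : Set where
    field
      {label}  : Fin (suc s)
      off      : ∀ i → v ≢ κ i
      labelled : LabelledBy κ v label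

  open Off-clique

  record P4-off {s} (κ : Fin s → V) : Set where
    constructor path
    field
      {a b c d} : V
      a∉ : Off-clique κ a
      b∉ : Off-clique κ b
      c∉ : Off-clique κ c
      d∉ : Off-clique κ d
      ab : a ~ b
      bc : b ~ c
      cd : c ~ d
      a≁c : a ≁ c
      a≁d : a ≁ d
      b≁d : b ≁ d

    labels : Labels s
    labels = label a∉ ∷ label b∉ ∷ label c∉ ∷ label d∉ ∷ []

  open P4-off

  reversed : ∀ {s} {κ : Fin s → V} → P4-off κ → P4-off κ
  reversed q = path (d∉ q) (c∉ q) (b∉ q) (a∉ q) (~-sym (cd q)) (~-sym (bc q)) (~-sym (ab q))
    (≁-sym (b≁d q)) (≁-sym (a≁d q)) (≁-sym (a≁c q))

  module _ {s} (κ : Fin s → V) (κ-clique : Clique κ) where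

    complete-copy : ∀ {m} {σ : Vec (Fin s) m} → AllPairs _≢_ σ → Copy (adj G) (map κ σ) (complete m)
    complete-copy []         = []
    complete-copy (_∷_ {x = i} {xs = js} i≢ ps) =
      (all-adjacent i≢ , VAll.map⁺ (VAll.map (λ i≢j → ~⇒≢ (κ-clique _ _ i≢j)) i≢)) ∷ complete-copy ps
      where
      all-adjacent : ∀ {m} {js : Vec (Fin s) m} → VAll (i ≢_) js → map (adj G (κ i)) (map κ js) ≡ replicate m true
      all-adjacent []        = refl
      all-adjacent (i≢j ∷ ps) = cong₂ _∷_ (κ-clique _ _ i≢j) (all-adjacent ps)

    fresh : ∀ {v} → Off-clique κ v → ∀ {m} (σ : Vec (Fin s) m) → VAll (v ≢_) (map κ σ)
    fresh v∉ σ = VAll.map⁺ (VAll.universal (off v∉) σ)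

    clique-row : ∀ {v} (v∉ : Off-clique κ v) {m} (σ : Vec (Fin s) m) →
      map (adj G v) (map κ σ) ≡ map (isLabel (label v∉)) σ
    clique-row {v} v∉ σ = trans (≡.sym (map-∘ (adj G v) κ σ)) (map-cong (labelled v∉) σ)

    framed-copy : (q : P4-off κ) → ∀ {cs σ} → Fits (labels q) cs σ →
      Copy (adj G) (a q ∷ b q ∷ c q ∷ d q ∷ map κ σ) (base cs)
    framed-copy (path a∉ b∉ c∉ d∉ ab bc cd a≁c a≁d b≁d) {σ = σ} (σ-distinct , eq) =
      subst (λ rows → Copy (adj G) _ (framed rows)) eq
        ( ( cong₂ _∷_ ab (cong₂ _∷_ (¬-not a≁c) (cong₂ _∷_ (¬-not a≁d) (clique-row a∉ σ)))
          , ~⇒≢ ab ∷ (λ { refl → a≁d cd }) ∷ (λ { refl → b≁d (~-sym ab) }) ∷ fresh a∉ σ)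
        ∷ ( cong₂ _∷_ bc (cong₂ _∷_ (¬-not b≁d) (clique-row b∉ σ))
          , ~⇒≢ bc ∷ (λ { refl → a≁d ab }) ∷ fresh b∉ σ)
        ∷ (cong₂ _∷_ cd (clique-row c∉ σ) , ~⇒≢ cd ∷ fresh c∉ σ)
        ∷ (clique-row d∉ σ , fresh d∉ σ)
        ∷ complete-copy σ-distinct)

  module _ (no-P2∪P4 : ¬ InducedSub 6 P2∪P4 G) (no-diamond : ¬ InducedSub 4 diamond G) where

    open Induced G

    labels-listed : ∀ {s} {κ : Fin s → V} → Clique κ → ∀ {css} → Exhaustive css →
      (q : P4-off κ) → Listed css (labels q)
    labels-listed {κ = κ} κ-clique exhaustive q
      with exhaustive (label (a∉ q)) (label (b∉ q)) (label (c∉ q)) (label (d∉ q))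
    ... | inj₂ listed = listed
    ... | inj₁ (i , j , i≢j , (a≢i , a≢j) ∷ (b≢i , b≢j) ∷ (c≢i , c≢j) ∷ (d≢i , d≢j) ∷ []) =
      ⊥-elim (P4-free-off-edge no-P2∪P4 (κ-clique i j i≢j)
        (missed (a∉ q) a≢i , missed (a∉ q) a≢j) (missed (b∉ q) b≢i , missed (b∉ q) b≢j)
        (missed (c∉ q) c≢i , missed (c∉ q) c≢j) (missed (d∉ q) d≢i , missed (d∉ q) d≢j)
        (ab q) (bc q) (cd q) (a≁c q) (a≁d q) (b≁d q))
      where
      missed : ∀ {v i} (v∉ : Off-clique κ v) → label v∉ ≢ suc i → v ≁ κ i
      missed {i = i} v∉ l≢ vi with label v∉ Fin.≟ suc i | trans (≡.sym vi) (labelled v∉ i)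
      ... | yes l≡ | _ = l≢ l≡

    colour-around-P4 : ∀ {s c} {κ : Fin s → V} → Clique κ →
      All (λ F → ∀ vs → ¬ Copy (adj G) vs (whole F)) (forbidden c) →
      (entries : List (Entry s c)) → Exhaustive (List.map Entry.labels entries) → P4-off κ → Colourable G (suc c)
    colour-around-P4 {s} {c} {κ} κ-clique absent entries exhaustive q =
      use entries (labels-listed κ-clique exhaustive q)
      where
      copied : ∀ e → Fits (labels q) (Entry.labels e) _ ⊎ Fits (reverse (labels q)) (Entry.labels e) _ →
        ∃ λ vs → Copy (adj G) vs (base (Entry.labels e))
      copied e (inj₁ fits) = _ , framed-copy κ κ-clique q fits
      copied e (inj₂ fits) = _ , framed-copy κ κ-clique (reversed q) fits
      use : ∀ es → Listed (List.map Entry.labels es) (labels q) → Colourable G (suc c)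
      use (_ ∷ es) (there l) = use es l
      use (e ∷ _) (here fits) = Sound.good-sound G (forbidden c) absent (Entry.table e)
        (Entry.verified e) (proj₂ (copied e fits))

    P4? : ∀ S → (∃ λ a → ∃ λ b → ∃ λ c → ∃ λ d → (a ∈ S × b ∈ S × c ∈ S × d ∈ S) ×
      (a ~ b × b ~ c × c ~ d × a ≁ c × a ≁ d × b ≁ d)) ⊎ P4Free (_∈ S)
    P4? S with Any.any? (λ a → Any.any? (λ b → Any.any? (λ c → Any.any? (λ d →
      (a ~? b) ×-dec (b ~? c) ×-dec (c ~? d) ×-dec ¬? (a ~? c) ×-dec ¬? (a ~? d) ×-dec ¬? (b ~? d)) S) S) S) S
    ... | no none = inj₂ λ a∈ b∈ c∈ d∈ ab bc cd ac ad bd →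
            none (lose a∈ (lose b∈ (lose c∈ (lose d∈ (ab , bc , cd , ac , ad , bd)))))
    ... | yes f with a , a∈ , f ← find f with b , b∈ , f ← find f with c , c∈ , f ← find f with d , d∈ , f ← find f =
      inj₁ (a , b , c , d , (a∈ , b∈ , c∈ , d∈) , f)

    open Large G (adjacent-across-edge no-diamond)

    module _ {k} (no-clique : ¬ HasClique G (5 + k)) (K : Fin (4 + k) → V) (K-clique : Clique K) where

      off-subclique : ∀ {s v} (f : Fin s → Fin (4 + k)) → (∀ {i j} → f i ≡ f j → i ≡ j) →
        v ∈ H no-clique K K-clique → Off-clique (K ∘ f) v
      off-subclique {v = v} f f-injective v∈ = record
        { label = proj₁ l ; off = λ i v≡ → H⁻ no-clique K K-clique v∈ (f i , v≡) ; labelled = proj₂ l }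
        where
        l = has-label (K ∘ f) v λ i j vi vj → f-injective (neighbour-unique no-clique K K-clique v∈ (f i) (f j) vi vj)

      -- The map `f` selects a subclique of `K`: for ω ≥ 6, six vertices already rule out a P₄.
      colour-unless-P4 : ∀ {s} (f : Fin s → Fin (4 + k)) → (∀ {i j} → f i ≡ f j → i ≡ j) →
        (P4-off (K ∘ f) → Colourable G (4 + k)) → Colourable G (4 + k)
      colour-unless-P4 f f-injective around with P4? (H no-clique K K-clique)
      ... | inj₂ p4 = colourable-off-P4 no-clique K K-clique p4
      ... | inj₁ (a , b , c , d , (a∈ , b∈ , c∈ , d∈) , ab , bc , cd , a≁c , a≁d , b≁d) = around
        (path (off-K a∈) (off-K b∈) (off-K c∈) (off-K d∈) ab bc cd a≁c a≁d b≁d)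
        where
        off-K : ∀ {v} → v ∈ H no-clique K K-clique → Off-clique (K ∘ f) v
        off-K = off-subclique f f-injective

    ω-colourable : ∀ k → HasClique G (4 + k) → ¬ HasClique G (5 + k) → Colourable G (4 + k)
    ω-colourable 0 (K , _ , K-clique) no-clique = colour-unless-P4 no-clique K K-clique id id
      (colour-around-P4 {4} {3} {K} K-clique (forbidden-absent no-P2∪P4 no-diamond 3 no-clique) entries₄ exhaustive₄)
    ω-colourable 1 (K , _ , K-clique) no-clique = colour-unless-P4 no-clique K K-clique id id
      (colour-around-P4 {5} {4} {K} K-clique (forbidden-absent no-P2∪P4 no-diamond 4 no-clique) entries₅ exhaustive₅)
    ω-colourable (suc (suc k)) (K , _ , K-clique) no-clique =
      colour-unless-P4 no-clique K K-clique first-six first-six-injective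
      λ q → ⊥-elim (nothing-listed {labels q}
        (labels-listed (λ i j i≢j → K-clique _ _ (i≢j ∘ first-six-injective)) exhaustive₆ q))
      where
      6≤ : 6 ≤ 6 + k
      6≤ = s≤s (s≤s (s≤s (s≤s (s≤s (s≤s z≤n)))))
      first-six : Fin 6 → Fin (6 + k)
      first-six i = inject≤ i 6≤
      first-six-injective : ∀ {i j} → first-six i ≡ first-six j → i ≡ j
      first-six-injective = inject≤-injective 6≤ 6≤ _ _
      nothing-listed : ∀ {ls : Labels 6} → ¬ Listed [] ls
      nothing-listed ()

-- Deciding the properties of concrete graphs

module Inspection (G : Graph) where

  open Adjacency G

  -- The middle edge `bc` comes first and each condition stands as early as possible, which prunes
  -- the evaluation.
  P4sIn : List V → Set
  P4sIn S = All (λ b → All (λ c → b ~ c → All (λ a → a ~ b → a ≁ c → All (λ d → c ~ d → b ≁ d → a ~ d) S) S) S) S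

  NoP2∪P4 NoDiamond NoK4 NoTriangle : Set
  NoP2∪P4 = ∀ u v → u ~ v → P4sIn (filter (λ x → ¬? (x ~? u) ×-dec ¬? (x ~? v)) (allFin _))
  NoDiamond = ∀ p q → p ~ q → ∀ x → x ~ p → x ~ q → ∀ y → y ~ p → y ~ q → x ≢ y → x ~ y
  NoTriangle = ∀ x y → x ~ y → ∀ z → y ~ z → x ≁ z
  NoK4 = ∀ x y → x ~ y → ∀ z → y ~ z → x ~ z → ∀ t → z ~ t → y ~ t → x ≁ t

  P4sIn? : ∀ S → Dec (P4sIn S)
  P4sIn? S = All.all? (λ b → All.all? (λ c → (b ~? c) →-dec All.all? (λ a → (a ~? b) →-dec (¬? (a ~? c)) →-dec
    All.all? (λ d → (c ~? d) →-dec (¬? (b ~? d)) →-dec (a ~? d)) S) S) S) S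

  noP2∪P4? : Dec NoP2∪P4
  noP2∪P4? = all? λ u → all? λ v → (u ~? v) →-dec P4sIn? _

  noDiamond? : Dec NoDiamond
  noDiamond? = all? λ p → all? λ q → (p ~? q) →-dec all? λ x → (x ~? p) →-dec (x ~? q) →-dec
    all? λ y → (y ~? p) →-dec (y ~? q) →-dec (¬? (x Fin.≟ y)) →-dec (x ~? y)

  noTriangle? : Dec NoTriangle
  noTriangle? = all? λ x → all? λ y → (x ~? y) →-dec all? λ z → (y ~? z) →-dec ¬? (x ~? z)

  noK4? : Dec NoK4
  noK4? = all? λ x → all? λ y → (x ~? y) →-dec all? λ z → (y ~? z) →-dec (x ~? z) →-dec
    all? λ t → (z ~? t) →-dec (y ~? t) →-dec ¬? (x ~? t)

  free : NoP2∪P4 → NoDiamond → P2∪P4-Diamond-Free G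
  free no-P2∪P4 no-diamond = without-P2∪P4 , without-diamond
    where
    without-P2∪P4 : ¬ InducedSub 6 P2∪P4 G
    without-P2∪P4 (f , _ , edges) = edges 2F 5F ⇏ All.lookup (All.lookup (All.lookup (All.lookup
        (no-P2∪P4 (f 0F) (f 1F) (edges 0F 1F)) (off 3F (edges 3F 0F) (edges 3F 1F)))
        (off 4F (edges 4F 0F) (edges 4F 1F)) (edges 3F 4F))
        (off 2F (edges 2F 0F) (edges 2F 1F)) (edges 2F 3F) (false⇒≁ (edges 2F 4F)))
        (off 5F (edges 5F 0F) (edges 5F 1F)) (edges 4F 5F) (false⇒≁ (edges 3F 5F))
      where
      false⇒≁ : ∀ {u v} → adj G u v ≡ false → u ≁ v
      false⇒≁ e e′ with () ← trans (≡.sym e) e′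
      _⇏_ : ∀ {u v} → adj G u v ≡ false → u ~ v → ⊥
      _⇏_ = false⇒≁
      off : ∀ i → adj G (f i) (f 0F) ≡ false → adj G (f i) (f 1F) ≡ false → f i ∈ _
      off i e₀ e₁ = ∈-filter⁺ (λ x → ¬? (x ~? f 0F) ×-dec ¬? (x ~? f 1F)) (∈-allFin (f i)) (false⇒≁ e₀ , false⇒≁ e₁)
    without-diamond : ¬ InducedSub 4 diamond G
    without-diamond (f , injective , edges)
      with () ← trans (≡.sym (edges 0F 3F)) (no-diamond (f 1F) (f 2F) (edges 1F 2F) (f 0F) (edges 0F 1F) (edges 0F 2F)
        (f 3F) (edges 3F 1F) (edges 3F 2F) (λ e → contradiction (injective e) λ ()))

  no-3-clique : NoTriangle → ¬ HasClique G 3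
  no-3-clique none (f , _ , c) = none (f 0F) (f 1F) (c 0F 1F λ ()) (f 2F) (c 1F 2F λ ()) (c 0F 2F λ ())

  no-4-clique : NoK4 → ¬ HasClique G 4
  no-4-clique none (f , _ , c) = none (f 0F) (f 1F) (c 0F 1F λ ()) (f 2F) (c 1F 2F λ ()) (c 0F 2F λ ())
    (f 3F) (c 2F 3F λ ()) (c 1F 3F λ ()) (c 0F 3F λ ())

  proper? : ∀ {c} (col : V → Fin c) → Dec (∀ u v → u ~ v → col u ≢ col v)
  proper? col = all? λ u → all? λ v → (u ~? v) →-dec ¬? (col u Fin.≟ col v)

  clique? : ∀ {k} (f : Fin k → V) → Dec (Clique f)
  clique? f = all? λ i → all? λ j → ¬? (i Fin.≟ j) →-dec (f i ~? f j)

  module _ {c : ℕ} where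

    -- A vertex with its remaining colours.
    Option : Set
    Option = V × List (Fin c)

    assign : V → Fin c → List Option → List Option
    assign v i = List.map λ (u , is) → u , (if adj G v u then filter (λ j → ¬? (i Fin.≟ j)) is else is)

    -- Branching where the fewest colours remain keeps the search small; a vertex with none left
    -- refutes at once.
    fewest : Option → List Option → Option × List Option
    fewest o []       = o , []
    fewest o (p ∷ ps) with length (proj₂ p) <ᵇ length (proj₂ o)
    ... | true  = let q , qs = fewest p ps in q , o ∷ qs
    ... | false = let q , qs = fewest o ps in q , p ∷ qs

    -- The number bounds the depth, and running out of it counts as failure. One more than the
    -- number of options is always enough.
    refuted : ℕ → List Option → Bool
    refuted zero    _        = false
    refuted (suc k) []       = false
    refuted (suc k) (o ∷ os) = branch (fewest o os)
      where
      branch : Option × List Option → Bool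
      branch ((v , is) , rest) = List.foldr (λ i b → if refuted k (assign v i rest) then b else false) true is

    -- A record for the same reason as `Verified`: type comparison must not rerun the search.
    record Refutation (os : List Option) : Set where
      constructor refutation
      field
        depth      : ℕ
        evaluation : refuted depth os ≡ true

    unrestricted : List V → List Option
    unrestricted = List.map λ v → v , allFin c

    module _ (col : V → Fin c) (proper : ∀ u v → u ~ v → col u ≢ col v) where

      Allowed : Option → Set
      Allowed (v , is) = col v ∈ is

      unrestricted-allowed : ∀ vs → All Allowed (unrestricted vs)
      unrestricted-allowed []       = []
      unrestricted-allowed (v ∷ vs) = ∈-allFin (col v) ∷ unrestricted-allowed vs

      fewest-allowed : ∀ o os → All Allowed (o ∷ os) → let p , ps = fewest o os in Allowed p × All Allowed ps
      fewest-allowed o []       (a ∷ []) = a , []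
      fewest-allowed o (p ∷ ps) (a ∷ b ∷ bs) with length (proj₂ p) <ᵇ length (proj₂ o)
      ... | true  = let c , cs = fewest-allowed p ps (b ∷ bs) in c , a ∷ cs
      ... | false = let c , cs = fewest-allowed o ps (a ∷ bs) in c , b ∷ cs

      assign-allowed : ∀ v {os} → All Allowed os → All Allowed (assign v (col v) os)
      assign-allowed v = All.map⁺ ∘ All.map (λ {(u , is)} → keep u is)
        where
        keep : ∀ u is → col u ∈ is → col u ∈ (if adj G v u then filter (λ j → ¬? (col v Fin.≟ j)) is else is)
        keep u is a with adj G v u in vu
        ... | true  = ∈-filter⁺ (λ j → ¬? (col v Fin.≟ j)) a (proper v u vu)
        ... | false = a

      -- At each vertex `v` the branch of its actual colour `col v` keeps all options allowed, so
      -- following it contradicts its refutation.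
      refuted-sound : ∀ k os → All Allowed os → refuted k os ≢ true
      refuted-sound (suc k) (o ∷ os) as eq with fewest o os | fewest-allowed o os as
      ... | (v , is) , rest | a , rest-allowed = go is a eq
        where
        go : ∀ is → col v ∈ is → List.foldr (λ i b → if refuted k (assign v i rest) then b else false) true is ≢ true
        go (i ∷ is) i∈ eq with refuted k (assign v i rest) in eq′
        go (i ∷ is) (here refl) eq | true = refuted-sound k _ (assign-allowed v rest-allowed) eq′
        go (i ∷ is) (there i∈) eq  | true = go is i∈ eq

      refutation-sound : ∀ {os} → Refutation os → ¬ All Allowed os
      refutation-sound (refutation k eq) as = refuted-sound k _ as eq

  transpose-injective : ∀ {c} (i j : Fin c) {x y} → transpose i j x ≡ transpose i j y → x ≡ y
  transpose-injective i j eq = trans (≡.sym (transpose-inverse j i)) (trans (cong (transpose j i) eq) (transpose-inverse j i))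

  recolour-injective : ∀ {c} (σ : Fin c → Fin c) → (∀ {x y} → σ x ≡ σ y → x ≡ y) → (col : V → Fin c) →
    (∀ u v → u ~ v → col u ≢ col v) → ∀ u v → u ~ v → σ (col u) ≢ σ (col v)
  recolour-injective σ σ-injective col proper u v uv = proper u v uv ∘ σ-injective

  transpose-hits : ∀ {c} (i j : Fin c) → transpose i j i ≡ j
  transpose-hits i j rewrite dec-true (i Fin.≟ i) refl = refl

  transpose-misses : ∀ {c} {i j k : Fin c} → k ≢ i → k ≢ j → transpose i j k ≡ k
  transpose-misses {i = i} {j} {k} k≢i k≢j rewrite dec-false (k Fin.≟ i) k≢i | dec-false (k Fin.≟ j) k≢j = refl

  -- By permuting colours a triangle may be assumed to have the colours 0, 1 and 2.
  normalised : ∀ {c} {x y z} → x ~ y → y ~ z → x ~ z → (col : V → Fin (3 + c)) →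
    (∀ u v → u ~ v → col u ≢ col v) →
    Σ (V → Fin (3 + c)) λ col′ → (∀ u v → u ~ v → col′ u ≢ col′ v) × col′ x ≡ 0F × col′ y ≡ 1F × col′ z ≡ 2F
  normalised {c} {x} {y} {z} xy yz xz col₀ proper₀ = col₃ , proper₃ , x₃ , y₃ , z₃
    where
    swap : Fin (3 + c) → V → (V → Fin (3 + c)) → V → Fin (3 + c)
    swap j v col = transpose (col v) j ∘ col
    col₁ = swap 0F x col₀
    proper₁ = recolour-injective (transpose (col₀ x) 0F) (transpose-injective _ _) col₀ proper₀
    x₁ : col₁ x ≡ 0F
    x₁ = transpose-hits (col₀ x) 0F
    col₂ = swap 1F y col₁
    proper₂ = recolour-injective (transpose (col₁ y) 1F) (transpose-injective _ _) col₁ proper₁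
    y₂ : col₂ y ≡ 1F
    y₂ = transpose-hits (col₁ y) 1F
    x₂ : col₂ x ≡ 0F
    -- Properness keeps the colour of `x` different from that of `y`, so the swap that places `y`
    -- fixes it; the same holds for the last swap.
    x₂ = trans (transpose-misses (proper₁ x y xy) (λ e → contradiction (trans (≡.sym e) x₁) λ ())) x₁
    col₃ = swap 2F z col₂
    proper₃ = recolour-injective (transpose (col₂ z) 2F) (transpose-injective _ _) col₂ proper₂
    z₃ : col₃ z ≡ 2F
    z₃ = transpose-hits (col₂ z) 2F
    x₃ : col₃ x ≡ 0F
    x₃ = trans (transpose-misses (proper₂ x z xz) (λ e → contradiction (trans (≡.sym e) x₂) λ ())) x₂
    y₃ : col₃ y ≡ 1F
    y₃ = trans (transpose-misses (proper₂ y z yz) (λ e → contradiction (trans (≡.sym e) y₂) λ ())) y₂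

-- The two extremal graphs

colourable-mono : ∀ G {c d} → c ≤ d → Colourable G c → Colourable G d
colourable-mono G c≤d (col , proper) = (λ v → inject≤ (col v) c≤d) ,
  λ u v uv eq → proper u v uv (Fin.inject≤-injective c≤d c≤d _ _ eq)

chromatic : ∀ G c → Colourable G (suc c) → ¬ Colourable G c → IsChromaticNumber G (suc c)
chromatic G c yes-c no-c = yes-c , λ d col → ≰⇒> λ d≤c → no-c (colourable-mono G d≤c col)

listed : ∀ {k} → Vec (List ℕ) k → Fin k → Fin k → Bool
listed neighbours u v = any (_≡ᵇ toℕ v) (lookup neighbours u)

irreflexive? : ∀ {k} (h : Fin k → Fin k → Bool) → Dec (∀ i → h i i ≡ false)
irreflexive? h = all? λ i → h i i Bool.≟ false

-- The Mycielskian of the 5-cycle 0, …, 4.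
grötzsch-neighbours : Vec (List ℕ) 11
grötzsch-neighbours =
    (1 ∷ 4 ∷ 6 ∷ 9 ∷ [])
  ∷ (0 ∷ 2 ∷ 5 ∷ 7 ∷ [])
  ∷ (1 ∷ 3 ∷ 6 ∷ 8 ∷ [])
  ∷ (2 ∷ 4 ∷ 7 ∷ 9 ∷ [])
  ∷ (0 ∷ 3 ∷ 5 ∷ 8 ∷ [])
  ∷ (1 ∷ 4 ∷ 10 ∷ [])
  ∷ (0 ∷ 2 ∷ 10 ∷ [])
  ∷ (1 ∷ 3 ∷ 10 ∷ [])
  ∷ (2 ∷ 4 ∷ 10 ∷ [])
  ∷ (0 ∷ 3 ∷ 10 ∷ [])
  ∷ (5 ∷ 6 ∷ 7 ∷ 8 ∷ 9 ∷ [])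
  ∷ []

grötzsch : Graph
grötzsch = record
  { n = 11 ; adj = listed grötzsch-neighbours
  ; sym = holds (symmetric? (listed grötzsch-neighbours)) refl
  ; irrefl = holds (irreflexive? (listed grötzsch-neighbours)) refl }

module Grötzsch where
  open Adjacency grötzsch
  open Inspection grötzsch

  is-free : P2∪P4-Diamond-Free grötzsch
  is-free = free (holds noP2∪P4? refl) (holds noDiamond? refl)

  an-edge : Fin 2 → V
  an-edge = lookup (# 0 ∷ # 1 ∷ [])

  clique-number : IsCliqueNumber grötzsch 2
  clique-number = hasClique {f = an-edge} (holds (clique? an-edge) refl) , no-3-clique (holds noTriangle? refl)

  four-colouring : V → Fin 4
  four-colouring = lookup (0F ∷ 1F ∷ 0F ∷ 1F ∷ 2F ∷ 0F ∷ 1F ∷ 0F ∷ 1F ∷ 2F ∷ 3F ∷ [])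

  options : List (Option {3})
  options = unrestricted (allFin 11)

  no-3-colouring : Refutation options
  no-3-colouring = refutation 12 refl

  chromatic-number : IsChromaticNumber grötzsch 4
  chromatic-number = chromatic grötzsch 3 (four-colouring , holds (proper? four-colouring) refl)
    λ (col , proper) → refutation-sound col proper no-3-colouring (unrestricted-allowed col proper (allFin 11))

-- The 27 lines on a smooth cubic surface, adjacent when they meet: a₁, …, a₆, b₁, …, b₆,
-- then c₁₂, c₁₃, c₂₃, c₁₄, …, c₅₆.
lines-neighbours : Vec (List ℕ) 27
lines-neighbours =
    (7 ∷ 8 ∷ 9 ∷ 10 ∷ 11 ∷ 12 ∷ 13 ∷ 15 ∷ 18 ∷ 22 ∷ [])
  ∷ (6 ∷ 8 ∷ 9 ∷ 10 ∷ 11 ∷ 12 ∷ 14 ∷ 16 ∷ 19 ∷ 23 ∷ [])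
  ∷ (6 ∷ 7 ∷ 9 ∷ 10 ∷ 11 ∷ 13 ∷ 14 ∷ 17 ∷ 20 ∷ 24 ∷ [])
  ∷ (6 ∷ 7 ∷ 8 ∷ 10 ∷ 11 ∷ 15 ∷ 16 ∷ 17 ∷ 21 ∷ 25 ∷ [])
  ∷ (6 ∷ 7 ∷ 8 ∷ 9 ∷ 11 ∷ 18 ∷ 19 ∷ 20 ∷ 21 ∷ 26 ∷ [])
  ∷ (6 ∷ 7 ∷ 8 ∷ 9 ∷ 10 ∷ 22 ∷ 23 ∷ 24 ∷ 25 ∷ 26 ∷ [])
  ∷ (1 ∷ 2 ∷ 3 ∷ 4 ∷ 5 ∷ 12 ∷ 13 ∷ 15 ∷ 18 ∷ 22 ∷ [])
  ∷ (0 ∷ 2 ∷ 3 ∷ 4 ∷ 5 ∷ 12 ∷ 14 ∷ 16 ∷ 19 ∷ 23 ∷ [])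
  ∷ (0 ∷ 1 ∷ 3 ∷ 4 ∷ 5 ∷ 13 ∷ 14 ∷ 17 ∷ 20 ∷ 24 ∷ [])
  ∷ (0 ∷ 1 ∷ 2 ∷ 4 ∷ 5 ∷ 15 ∷ 16 ∷ 17 ∷ 21 ∷ 25 ∷ [])
  ∷ (0 ∷ 1 ∷ 2 ∷ 3 ∷ 5 ∷ 18 ∷ 19 ∷ 20 ∷ 21 ∷ 26 ∷ [])
  ∷ (0 ∷ 1 ∷ 2 ∷ 3 ∷ 4 ∷ 22 ∷ 23 ∷ 24 ∷ 25 ∷ 26 ∷ [])
  ∷ (0 ∷ 1 ∷ 6 ∷ 7 ∷ 17 ∷ 20 ∷ 21 ∷ 24 ∷ 25 ∷ 26 ∷ [])
  ∷ (0 ∷ 2 ∷ 6 ∷ 8 ∷ 16 ∷ 19 ∷ 21 ∷ 23 ∷ 25 ∷ 26 ∷ [])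
  ∷ (1 ∷ 2 ∷ 7 ∷ 8 ∷ 15 ∷ 18 ∷ 21 ∷ 22 ∷ 25 ∷ 26 ∷ [])
  ∷ (0 ∷ 3 ∷ 6 ∷ 9 ∷ 14 ∷ 19 ∷ 20 ∷ 23 ∷ 24 ∷ 26 ∷ [])
  ∷ (1 ∷ 3 ∷ 7 ∷ 9 ∷ 13 ∷ 18 ∷ 20 ∷ 22 ∷ 24 ∷ 26 ∷ [])
  ∷ (2 ∷ 3 ∷ 8 ∷ 9 ∷ 12 ∷ 18 ∷ 19 ∷ 22 ∷ 23 ∷ 26 ∷ [])
  ∷ (0 ∷ 4 ∷ 6 ∷ 10 ∷ 14 ∷ 16 ∷ 17 ∷ 23 ∷ 24 ∷ 25 ∷ [])
  ∷ (1 ∷ 4 ∷ 7 ∷ 10 ∷ 13 ∷ 15 ∷ 17 ∷ 22 ∷ 24 ∷ 25 ∷ [])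
  ∷ (2 ∷ 4 ∷ 8 ∷ 10 ∷ 12 ∷ 15 ∷ 16 ∷ 22 ∷ 23 ∷ 25 ∷ [])
  ∷ (3 ∷ 4 ∷ 9 ∷ 10 ∷ 12 ∷ 13 ∷ 14 ∷ 22 ∷ 23 ∷ 24 ∷ [])
  ∷ (0 ∷ 5 ∷ 6 ∷ 11 ∷ 14 ∷ 16 ∷ 17 ∷ 19 ∷ 20 ∷ 21 ∷ [])
  ∷ (1 ∷ 5 ∷ 7 ∷ 11 ∷ 13 ∷ 15 ∷ 17 ∷ 18 ∷ 20 ∷ 21 ∷ [])
  ∷ (2 ∷ 5 ∷ 8 ∷ 11 ∷ 12 ∷ 15 ∷ 16 ∷ 18 ∷ 19 ∷ 21 ∷ [])
  ∷ (3 ∷ 5 ∷ 9 ∷ 11 ∷ 12 ∷ 13 ∷ 14 ∷ 18 ∷ 19 ∷ 20 ∷ [])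
  ∷ (4 ∷ 5 ∷ 10 ∷ 11 ∷ 12 ∷ 13 ∷ 14 ∷ 15 ∷ 16 ∷ 17 ∷ [])
  ∷ []

lines : Graph
lines = record
  { n = 27 ; adj = listed lines-neighbours
  ; sym = holds (symmetric? (listed lines-neighbours)) refl
  ; irrefl = holds (irreflexive? (listed lines-neighbours)) refl }

module Lines where
  open Adjacency lines
  open Inspection lines

  is-free : P2∪P4-Diamond-Free lines
  is-free = free (holds noP2∪P4? refl) (holds noDiamond? refl)

  tritangent : Fin 3 → V
  -- The lines c₃₆, c₂₅ and c₁₄, whose index pairs are disjoint.
  tritangent = lookup (# 24 ∷ # 19 ∷ # 15 ∷ [])

  clique-number : IsCliqueNumber lines 3
  clique-number = hasClique {f = tritangent} (holds (clique? tritangent) refl) , no-4-clique (holds noK4? refl)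

  six-colouring : V → Fin 6
  -- The classes are all aᵢ, all bᵢ, the cᵢⱼ with indices at most 3, and then the remaining cᵢⱼ with
  -- index 4, with index 5 and with index 6. Lines cᵢⱼ that share an index are skew.
  six-colouring = lookup (0F ∷ 0F ∷ 0F ∷ 0F ∷ 0F ∷ 0F ∷ 1F ∷ 1F ∷ 1F ∷ 1F ∷ 1F ∷ 1F ∷ 2F ∷ 2F ∷ 2F ∷ 3F ∷ 3F ∷ 3F ∷ 4F ∷ 4F ∷ 4F ∷ 3F ∷ 5F ∷ 5F ∷ 5F ∷ 3F ∷ 4F ∷ [])

  -- The lines a₅ and b₂ are not needed: the other 25 already have no 5-colouring.
  others : List V
  others = filter (λ v → All.all? (λ u → ¬? (v Fin.≟ u)) (# 24 ∷ # 19 ∷ # 15 ∷ # 4 ∷ # 7 ∷ [])) (allFin 27)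

  options : List (Option {5})
  options = (# 24 , 0F ∷ []) ∷ (# 19 , 1F ∷ []) ∷ (# 15 , 2F ∷ []) ∷ unrestricted others

  no-5-colouring : Refutation options
  no-5-colouring = refutation 26 refl

  chromatic-number : IsChromaticNumber lines 6
  chromatic-number = chromatic lines 5 (six-colouring , holds (proper? six-colouring) refl)
    λ (col , proper) → let col′ , proper′ , x , y , z =
                             normalised {x = # 24} {# 19} {# 15} refl refl refl col proper in
      refutation-sound col′ proper′ no-5-colouring
        (here x ∷ here y ∷ here z ∷ unrestricted-allowed col′ proper′ others)

-- The bounds and their tightness

theorem1p3 : ((G : Graph) → P2∪P4-Diamond-Free G → (w c : ℕ) →
    IsCliqueNumber G w → IsChromaticNumber G c →
    (w ≡ 2 → c ≤ 4) × (w ≡ 3 → c ≤ 6) × (4 ≤ w → c ≡ w))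
    × Σ Graph (λ G → P2∪P4-Diamond-Free G × IsCliqueNumber G 2 × IsChromaticNumber G 4)
    × Σ Graph (λ G → P2∪P4-Diamond-Free G × IsCliqueNumber G 3 × IsChromaticNumber G 6)
theorem1p3 = bounds
  , (grötzsch , Grötzsch.is-free , Grötzsch.clique-number , Grötzsch.chromatic-number)
  , (lines , Lines.is-free , Lines.clique-number , Lines.chromatic-number)
  where
  bounds : (G : Graph) → P2∪P4-Diamond-Free G → (w c : ℕ) → IsCliqueNumber G w → IsChromaticNumber G c →
    (w ≡ 2 → c ≤ 4) × (w ≡ 3 → c ≤ 6) × (4 ≤ w → c ≡ w)
  bounds G (no-P2∪P4 , no-diamond) w c ((f , f-injective , f-clique) , no-larger) ((col , proper) , minimal) =
    (λ { refl → minimal 4 (4-colourable no-larger (f-clique 0F 1F λ ())) }) ,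
    (λ { refl → minimal 6 (6-colourable no-larger (f-clique 0F 1F λ ())) }) ,
    large
    where
    open Induced G
    open Free G (adjacent-across-edge no-diamond) (P4-free-off-edge no-P2∪P4)
    w≤c : w ≤ c
    w≤c = injective⇒≤ {f = col ∘ f} λ {i} {j} eq → decidable-stable (i Fin.≟ j) λ i≢j → proper _ _ (f-clique i j i≢j) eq
    large : 4 ≤ w → c ≡ w
    large 4≤w with w ∸ 4 | m+[n∸m]≡n 4≤w
    ... | k | refl = ≤-antisym
      (minimal w (ω-colourable G no-P2∪P4 no-diamond k (f , f-injective , f-clique) no-larger)) w≤c
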